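{- The problem RANK INTEGRITY is $\mathrm{W}[1]$-hard parameterized by $k$.
   Context: Graphs are finite, simple and undirected. For graphs $G,G'$ on the same vertex set $V$, $G+G'$ is the graph on $V$ whose edge set is the symmetric difference of the edge sets of $G$ and $G'$. The minimum rank of a graph is the minimum, over all ways of filling in the diagonal of its adjacency matrix with $0$s and $1$s, of the rank of the resulting matrix over $\mathrm{GF}(2)$. The $k$-rank-integrity of $G$ is the minimum, over all graphs $G'$ on $V(G)$ such that $G+G'$ has minimum rank at most $k$, of the maximum component size of $G'$ (the size of a component is its number of vertices). The problem RANK INTEGRITY asks, given a graph $G$ and an integer $k$, to compute the $k$-rank-integrity of $G$; as a decision problem: given a graph $G$ and integers $k$ and $t$, decide whether the $k$-rank-integrity of $G$ is at most $t$, with parameter $k$. $\mathrm{W}[1]$-hardness is with respect to parameterized (fpt) reductions; equivalently, there is a parameterized reduction to this problem from CLIQUE (given a graph and an integer $k$, decide whether the graph has a clique of size $k$) parameterized by $k$. -}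

module Defs where

open import Algebra.Bundles using (CommutativeRing)
open import Data.Bool.Base using (Bool; true; false; if_then_else_; _∧_; _xor_)
open import Data.Bool.Properties using (xor-∧-commutativeRing)
open import Data.Fin.Base using (Fin; toℕ)
open import Data.Fin.Properties using (_≟_)
open import Data.Fin.Subset using (Subset; _∈_; ∣_∣; Nonempty)
open import Data.List.Base as List using (List; []; _∷_; length; lookup; concat; tabulate)
open import Data.Nat.Base using (ℕ; zero; suc; _+_; _*_; _∸_; _^_; _≤_; _≡ᵇ_)
open import Data.Nat.ListAction using () renaming (sum to sumℕ)
open import Data.Nat.Logarithm using (⌊log₂_⌋)
open import Data.Product.Base using (Σ; _×_; _,_; ∃-syntax)
open import Data.Sum.Base using (_⊎_)
open import Function.Bundles using (_⇔_)
open import Relation.Binary.Construct.Closure.ReflexiveTransitive using (Star)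
open import Relation.Binary.PropositionalEquality
  using (_≡_; _≢_; cong₂)
open import Relation.Nullary.Decidable using (does)

import Algebra.Properties.CommutativeMonoid.Sum as CMSum

IsMin : (ℕ → Set) → ℕ → Set
IsMin P m = P m × (∀ j → P j → m ≤ j)

IsMax : (ℕ → Set) → ℕ → Set
IsMax P m = P m × (∀ j → P j → j ≤ m)

------------------------------------------------------------------------
-- Rank over GF(2), realised as Bool with addition xor and product ∧

open CMSum (CommutativeRing.+-commutativeMonoid xor-∧-commutativeRing)
  using () renaming (sum to sumGF2)

Matrix : ℕ → ℕ → Set
Matrix m n = Fin m → Fin n → Bool

LinearlyIndependent : ∀ {r n} → (Fin r → (Fin n → Bool)) → Set
LinearlyIndependent {r} v =
  (c : Fin r → Bool) →
  (∀ j → sumGF2 (λ i → c i ∧ v i j) ≡ false) →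
  ∀ i → c i ≡ false

-- The rank is the largest number of linearly independent rows; an
-- independent selection ρ of rows is automatically injective.
HasRank : ∀ {m n} → Matrix m n → ℕ → Set
HasRank {m} M =
  IsMax (λ r → Σ (Fin r → Fin m) λ ρ → LinearlyIndependent (λ i → M (ρ i)))

------------------------------------------------------------------------
-- Graphs

record Graph (n : ℕ) : Set where
  field
    adj       : Fin n → Fin n → Bool
    symmetric : ∀ u v → adj u v ≡ adj v u
    loopless  : ∀ v → adj v v ≡ false

open Graph public

Edge : ∀ {n} → Graph n → Fin n → Fin n → Set
Edge G u v = adj G u v ≡ true

infixl 6 _⊕_

_⊕_ : ∀ {n} → Graph n → Graph n → Graph n
(G ⊕ H) .adj u v       = adj G u v xor adj H u v
(G ⊕ H) .symmetric u v = cong₂ _xor_ (symmetric G u v) (symmetric H u v)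
(G ⊕ H) .loopless v    = cong₂ _xor_ (loopless G v) (loopless H v)

fillDiagonal : ∀ {n} → Graph n → (Fin n → Bool) → Matrix n n
fillDiagonal G d u v = if does (u ≟ v) then d u else adj G u v

MinimumRank : ∀ {n} → Graph n → ℕ → Set
MinimumRank {n} G =
  IsMin (λ r → Σ (Fin n → Bool) λ d → HasRank (fillDiagonal G d) r)

IsComponent : ∀ {n} → Graph n → Subset n → Set
IsComponent G C =
  Nonempty C × (∀ u v → u ∈ C → (v ∈ C ⇔ Star (Edge G) u v))

-- The graph without vertices has no component; its maximum component size
-- is 0 by convention.
MaxComponentSize : ∀ {n} → Graph n → ℕ → Set
MaxComponentSize {n} G s =
  (n ≡ 0 × s ≡ 0) ⊎
  IsMax (λ m → ∃[ C ] (IsComponent G C × ∣ C ∣ ≡ m)) s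

RankIntegrity : ∀ {n} → Graph n → ℕ → ℕ → Set
RankIntegrity {n} G k =
  IsMin (λ s → Σ (Graph n) λ G′ →
    (∃[ r ] (MinimumRank (G ⊕ G′) r × r ≤ k)) × MaxComponentSize G′ s)

IsClique : ∀ {n} → Graph n → Subset n → Set
IsClique G C = ∀ u v → u ∈ C → v ∈ C → u ≢ v → Edge G u v

------------------------------------------------------------------------
-- Model of computation: random access machines with a structured program
-- text.  A machine has registers and arrays of natural numbers, both named
-- by ℕ; a program mentions only finitely many names.  Each executed
-- assignment or test costs one step.  This agrees with charging every
-- arithmetic operation and memory access up to a constant factor depending
-- only on the program.  There is no multiplication, so numbers gain O(1)
-- bits per step, and running times are polynomially related to those of
-- Turing machines.

data Expr : Set where
  lit  : ℕ → Expr
  reg  : ℕ → Expr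
  arr  : ℕ → Expr → Expr
  plus monus : Expr → Expr → Expr

infixr 5 _⨾_

data Program : Set where
  skip         : Program
  setReg       : ℕ → Expr → Program
  setArr       : ℕ → (index value : Expr) → Program
  _⨾_          : Program → Program → Program
  ifNonzero    : Expr → (then else : Program) → Program
  whileNonzero : Expr → Program → Program

record State : Set where
  constructor state
  field
    regs : ℕ → ℕ
    arrs : ℕ → ℕ → ℕ

open State public

_[_↦_] : {A : Set} → (ℕ → A) → ℕ → A → (ℕ → A)
(f [ i ↦ x ]) j = if j ≡ᵇ i then x else f j

⟦_⟧ : Expr → State → ℕ
⟦ lit m ⟧ σ     = m
⟦ reg x ⟧ σ     = regs σ x
⟦ arr a e ⟧ σ   = arrs σ a (⟦ e ⟧ σ)
⟦ plus e f ⟧ σ  = ⟦ e ⟧ σ + ⟦ f ⟧ σ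
⟦ monus e f ⟧ σ = ⟦ e ⟧ σ ∸ ⟦ f ⟧ σ

-- Exec p σ t τ: started in σ, the program p halts in τ after t steps.
data Exec : Program → State → ℕ → State → Set where
  skip : ∀ {σ} → Exec skip σ 1 σ
  setReg : ∀ {x e σ} →
    Exec (setReg x e) σ 1 (state (regs σ [ x ↦ ⟦ e ⟧ σ ]) (arrs σ))
  setArr : ∀ {a i e σ} →
    Exec (setArr a i e) σ 1
      (state (regs σ) (arrs σ [ a ↦ arrs σ a [ ⟦ i ⟧ σ ↦ ⟦ e ⟧ σ ] ]))
  _⨾_ : ∀ {p q σ τ υ s t} →
    Exec p σ s τ → Exec q τ t υ → Exec (p ⨾ q) σ (s + t) υ
  ifTrue : ∀ {e p q σ τ t} →
    ⟦ e ⟧ σ ≢ 0 → Exec p σ t τ → Exec (ifNonzero e p q) σ (suc t) τ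
  ifFalse : ∀ {e p q σ τ t} →
    ⟦ e ⟧ σ ≡ 0 → Exec q σ t τ → Exec (ifNonzero e p q) σ (suc t) τ
  whileStop : ∀ {e p σ} →
    ⟦ e ⟧ σ ≡ 0 → Exec (whileNonzero e p) σ 1 σ
  whileStep : ∀ {e p σ τ υ s t} →
    ⟦ e ⟧ σ ≢ 0 → Exec p σ s τ → Exec (whileNonzero e p) τ t υ →
    Exec (whileNonzero e p) σ (suc (s + t)) υ

nth : List ℕ → ℕ → ℕ
nth []       _       = 0
nth (x ∷ xs) zero    = x
nth (x ∷ xs) (suc i) = nth xs i

-- The input list is in array 0 and its length in register 0; all other
-- registers and cells are 0.  The output is read from array 1, with its
-- length in register 0; cells beyond that length are ignored.
input : List ℕ → State
input xs .regs zero          = length xs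
input xs .regs (suc _)       = 0
input xs .arrs zero i        = nth xs i
input xs .arrs (suc _) _     = 0

HasOutput : State → List ℕ → Set
HasOutput σ ys =
  regs σ 0 ≡ length ys ×
  (∀ (i : Fin (length ys)) → arrs σ 1 (toℕ i) ≡ lookup ys i)

HaltsWith : Program → List ℕ → ℕ → List ℕ → Set
HaltsWith p xs t ys = ∃[ σ ] (Exec p (input xs) t σ × HasOutput σ ys)

Computable : (ℕ → ℕ) → Set
Computable f =
  Σ Program λ p → ∀ m → ∃[ t ] HaltsWith p (m ∷ []) t (f m ∷ [])

-- Total number of binary digits.
size : List ℕ → ℕ
size xs = sumℕ (List.map (λ x → suc ⌊log₂ x ⌋) xs)

------------------------------------------------------------------------
-- Parameterized problems and reductions

record ParameterizedProblem : Set₁ where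
  field
    Instance  : Set
    encode    : Instance → List ℕ
    parameter : Instance → ℕ
    Yes       : Instance → Set

open ParameterizedProblem public

record _≤fpt_ (P Q : ParameterizedProblem) : Set where
  field
    reduce  : Instance P → Instance Q
    correct : ∀ x → Yes P x ⇔ Yes Q (reduce x)

    parameterBound           : ℕ → ℕ
    parameterBound-computable : Computable parameterBound
    parameter-bounded        :
      ∀ x → parameter Q (reduce x) ≤ parameterBound (parameter P x)

    program           : Program
    factor            : ℕ → ℕ
    factor-computable : Computable factor
    exponent          : ℕ
    runs              : ∀ x → ∃[ t ]
      ( HaltsWith program (encode P x) t (encode Q (reduce x))
      × t ≤ factor (parameter P x) * size (encode P x) ^ exponent )

encodeGraph : ∀ {n} → Graph n → List ℕ
encodeGraph G =
  concat (tabulate λ u → tabulate λ v → if adj G u v then 1 else 0)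

CLIQUE : ParameterizedProblem
CLIQUE = record
  { Instance  = Σ ℕ λ n → Graph n × ℕ
  ; encode    = λ (n , G , k) → n ∷ k ∷ encodeGraph G
  ; parameter = λ (n , G , k) → k
  ; Yes       = λ (n , G , k) → ∃[ C ] (IsClique G C × ∣ C ∣ ≡ k)
  }

RANK-INTEGRITY : ParameterizedProblem
RANK-INTEGRITY = record
  { Instance  = Σ ℕ λ n → Graph n × ℕ × ℕ
  ; encode    = λ (n , G , k , t) → n ∷ k ∷ t ∷ encodeGraph G
  ; parameter = λ (n , G , k , t) → k
  ; Yes       = λ (n , G , k , t) → ∃[ s ] (RankIntegrity G k s × s ≤ t)
  }

-- CLIQUE parameterized by the clique size is W[1]-complete, so hardness for
-- W[1] is the existence of a parameterized reduction from it.
W[1]-Hard : ParameterizedProblem → Set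
W[1]-Hard Q = CLIQUE ≤fpt Q

{-# OPTIONS --safe #-}
module Submission where

-- From G and k build a graph H on P hubs (the vertices of G and some padding) and
-- further vertices, each adjacent to hubs only: for every ordered pair of hubs a
-- subdivider, which makes H robustly connected, and a second vertex, adjacent to
-- just these two hubs if they are equal or adjacent in G and to all hubs
-- otherwise; and at every hub as many pendants as there are other vertices.
-- Removing a k-clique of hubs cuts off quota k vertices, the largest possible
-- number.
--
-- Removal of k hubs is a perturbation of rank k: for every hub h flip the pairs
-- within h and its neighbours that are not cut off.  Conversely, a modification
-- of rank at most k whose components have at most N − quota k vertices splits H
-- into two large sides, and the adjacency matrix of H between them has rank at
-- most k.  The side with few hubs touches at most k of them, because every
-- touched hub gives an entry of an identity submatrix, and at least k of them,
-- because it is large.  A vertex of this side with another neighbour would raise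
-- the rank, so the side lies within what its k touched hubs cut off, and its size
-- forces these hubs to form a clique.

-- A modification may change pairs within a side arbitrarily. What survives is that `G′` has no edge
-- leaving a union of its components, so across such a cut the low-rank matrix equals the adjacency
-- matrix of `H`; everything about the clique has to be read from that submatrix and from the sizes
-- of the two sides. With as many pendants at each hub as there are other vertices, the size of a
-- side bounds from below the number of hubs whose pendants it meets. The second vertex of an
-- incompatible pair sees all hubs, so no removal of k hubs cuts it off and it is missing from the
-- count. Padding supplies enough hubs beyond the cut to pair with the touched ones, and makes N at
-- least three times `quota k`, as a balanced cut requires.
--
-- A yes-instance refers to the exact rank integrity, a minimum over graphs that involves minimum
-- ranks and maximum component sizes. Constructively these extrema must be shown to exist, hence the
-- decidable search over graphs, diagonals and selections of rows. The parameter is kept; k enters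
-- the time bound through a factor of its own because k is written in binary and may far exceed the
-- input size.

open import Algebra.Bundles using (CommutativeRing)
open import Data.Bool.Base using (Bool; true; false; T; not; if_then_else_; _∧_; _∨_; _xor_)
import Data.Bool.Properties as 𝔹
open import Data.Empty using (⊥; ⊥-elim)
open import Data.Fin.Base using (Fin; zero; suc; toℕ; fromℕ<; combine; remQuot; splitAt; join; _↑ˡ_; _↑ʳ_; finToFun; funToFin; inject≤)
import Data.Fin.Properties as 𝔽
open import Data.Fin.Subset using (Subset; _∈_; ∣_∣)
import Data.Fin.Subset.Properties as 𝕊
open import Data.List.Base as List using (List; []; _∷_; _++_; length; concat; tabulate; take)
import Data.List.Properties as 𝕃
open import Data.List.Membership.Propositional using () renaming (_∈_ to _∈ˡ_)
open import Data.List.Membership.Propositional.Properties using (∈-allFin)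
open import Data.List.Relation.Unary.Any using (here; there)
open import Data.Nat.Base using (ℕ; zero; suc; _+_; _*_; _∸_; _^_; _≤_; _<_; _≡ᵇ_; z≤n; s≤s; z<s; s<s; s≤s⁻¹)
open import Data.Nat.Logarithm using (⌊log₂_⌋)
import Data.Nat.Properties as ℕ
open import Data.Nat.Tactic.RingSolver using (solve-∀)
open import Data.Product.Base using (Σ; ∃; ∃-syntax; _×_; _,_; proj₁; proj₂)
open import Data.Sum.Base as Sum using (_⊎_; inj₁; inj₂)
open import Data.Vec.Base as Vec using ([]; _∷_)
import Data.Vec.Properties as 𝕍
open import Function.Base using (_∘_; id; case_of_)
open import Function.Bundles using (_⇔_; mk⇔; Equivalence)
open import Relation.Binary.Construct.Closure.ReflexiveTransitive using (Star; ε; _◅_; _◅◅_)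
open import Relation.Binary.PropositionalEquality using (_≡_; _≢_; _≗_; refl; sym; trans; cong; cong₂; subst; module ≡-Reasoning)
open import Relation.Nullary.Decidable using (Dec; yes; no; does; map′; ¬?; _×-dec_; _→-dec_; decidable-stable; dec-true; dec-false)
open import Relation.Nullary.Negation using (¬_; contradiction)

import Algebra.Properties.Semiring.Sum as SemiringSum

open import Defs

-- Decidability of finite search

-- Functions out of a finite type are only searchable up to pointwise equality,
-- hence the explicit relation.
Search : (A : Set) → (A → A → Set) → Set₁
Search A _≈_ = (P : A → Set) → (∀ {x y} → x ≈ y → P x → P y) → (∀ x → Dec (P x)) → Dec (Σ A P)

search-Bool : Search Bool _≡_
search-Bool P _ P? with P? true | P? false
... | yes p | _     = yes (true , p)
... | no ¬p | yes q = yes (false , q)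
... | no ¬p | no ¬q = no λ { (true , p) → ¬p p ; (false , q) → ¬q q }

search-Fin : ∀ {n} → Search (Fin n) _≡_
search-Fin P _ P? = 𝔽.any? P?

cons : ∀ {A : Set} {r} → A → (Fin r → A) → Fin (suc r) → A
cons a f zero    = a
cons a f (suc i) = f i

search-→ : ∀ {A : Set} {_≈_ : A → A → Set} → (∀ {x} → x ≈ x) → Search A _≈_ →
           ∀ {r} → Search (Fin r → A) (λ f g → ∀ i → f i ≈ g i)
search-→ ≈-refl searchA {zero} P resp P? =
  map′ (λ p → none , p) (λ (f , p) → resp (λ ()) p) (P? none)
  where
  none : Fin 0 → _
  none ()
search-→ {_≈_ = _≈_} ≈-refl searchA {suc r} P resp P? =
  map′ (λ (a , f , p) → cons a f , p)
       -- `cons (f zero) (f ∘ suc)` agrees with `f` only pointwise, so `resp` has to bridge the gap.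
       (λ (f , p) → f zero , f ∘ suc , resp (λ { zero → ≈-refl ; (suc _) → ≈-refl }) p)
       (searchA (λ a → Σ _ λ f → P (cons a f))
         (λ a≈b (f , p) → f , resp (λ { zero → a≈b ; (suc _) → ≈-refl }) p)
         (λ a → search-→ ≈-refl searchA (λ f → P (cons a f))
           (λ f≈g → resp (λ { zero → ≈-refl ; (suc i) → f≈g i }))
           (λ f → P? (cons a f))))

search-∀ : ∀ {A : Set} {_≈_ : A → A → Set} → (∀ {x y} → x ≈ y → y ≈ x) → Search A _≈_ →
           (P : A → Set) → (∀ {x y} → x ≈ y → P x → P y) → (∀ x → Dec (P x)) → Dec (∀ x → P x)
search-∀ ≈-sym searchA P resp P? =
  map′ (λ ¬∃¬ x → decidable-stable (P? x) (λ ¬p → ¬∃¬ (x , ¬p)))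
       (λ p (x , ¬px) → ¬px (p x))
       (¬? (searchA (λ x → ¬ P x) (λ x≈y ¬px py → ¬px (resp (≈-sym x≈y) py)) (λ x → ¬? (P? x))))

least : (P : ℕ → Set) → (∀ m → Dec (P m)) → ∀ b → P b → ∃ λ m → IsMin P m × m ≤ b
least P P? zero    p = 0 , (p , λ _ _ → z≤n) , z≤n
least P P? (suc b) p with P? 0
... | yes p₀ = 0 , (p₀ , λ _ _ → z≤n) , z≤n
... | no ¬p₀ with m , (pm , m-min) , m≤b ← least (P ∘ suc) (P? ∘ suc) b p =
  suc m , (pm , λ { zero p₀ → contradiction p₀ ¬p₀ ; (suc j) pj → s≤s (m-min j pj) }) , s≤s m≤b

greatest : (P : ℕ → Set) → (∀ m → Dec (P m)) → ∀ b → (∀ j → P j → j ≤ b) → ∃ P → ∃ (IsMax P)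
greatest P P? zero    bound (zero , p)  = 0 , p , bound
greatest P P? zero    bound (suc m , p) = contradiction (bound _ p) λ ()
greatest P P? (suc b) bound ∃P with P? (suc b)
... | yes p = suc b , p , bound
... | no ¬p = greatest P P? b (λ j pj → s≤s⁻¹ (ℕ.≤∧≢⇒< (bound j pj) λ { refl → ¬p pj })) ∃P

IsMin-unique : ∀ {P : ℕ → Set} {a b} → IsMin P a → IsMin P b → a ≡ b
IsMin-unique (pa , min-a) (pb , min-b) = ℕ.≤-antisym (min-a _ pb) (min-b _ pa)

IsMax-unique : ∀ {P : ℕ → Set} {a b} → IsMax P a → IsMax P b → a ≡ b
IsMax-unique (pa , max-a) (pb , max-b) = ℕ.≤-antisym (max-b _ pa) (max-a _ pb)

IsMax-resp : ∀ {P Q : ℕ → Set} → (∀ {j} → P j → Q j) → (∀ {j} → Q j → P j) → ∀ {m} → IsMax P m → IsMax Q m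
IsMax-resp P⇒Q Q⇒P (p , max) = P⇒Q p , λ j q → max j (Q⇒P q)

IsMin-resp : ∀ {P Q : ℕ → Set} → (∀ {j} → P j → Q j) → (∀ {j} → Q j → P j) → ∀ {m} → IsMin P m → IsMin Q m
IsMin-resp P⇒Q Q⇒P (p , min) = P⇒Q p , λ j q → min j (Q⇒P q)

-- Rank over GF(2)

open SemiringSum (CommutativeRing.semiring 𝔹.xor-∧-commutativeRing)
  using (∑-comm; ∑-distrib-+; *-distribˡ-sum; *-distribʳ-sum; sum-cong-≗; sum-replicate-zero)
  renaming (sum to sumGF2)

LinearlyIndependent-resp : ∀ {r n} {v w : Fin r → Fin n → Bool} → (∀ i j → v i j ≡ w i j) →
                           LinearlyIndependent v → LinearlyIndependent w
LinearlyIndependent-resp v≈w indep c eq =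
  indep c λ j → trans (sum-cong-≗ λ i → cong (c i ∧_) (v≈w i j)) (eq j)

linearlyIndependent? : ∀ {r n} (v : Fin r → Fin n → Bool) → Dec (LinearlyIndependent v)
linearlyIndependent? v = search-∀ (λ eq i → sym (eq i)) (search-→ refl search-Bool)
  (λ c → (∀ j → sumGF2 (λ i → c i ∧ v i j) ≡ false) → ∀ i → c i ≡ false)
  (λ {c} {d} c≈d indep eq i →
    trans (sym (c≈d i))
          (indep (λ j → trans (sum-cong-≗ λ i → cong (_∧ v i j) (c≈d i)) (eq j)) i))
  (λ c → 𝔽.all? (λ j → _ 𝔹.≟ false) →-dec 𝔽.all? (λ i → c i 𝔹.≟ false))

IndependentRows : ∀ {m n} → Matrix m n → ℕ → Set
IndependentRows {m} M r = Σ (Fin r → Fin m) λ ρ → LinearlyIndependent (λ i → M (ρ i))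

independentRows? : ∀ {m n} (M : Matrix m n) r → Dec (IndependentRows M r)
independentRows? M r = search-→ refl search-Fin (λ ρ → LinearlyIndependent (λ i → M (ρ i)))
  (λ ρ≈σ → LinearlyIndependent-resp (λ i j → cong (λ x → M x j) (ρ≈σ i)))
  (λ ρ → linearlyIndependent? (λ i → M (ρ i)))

sum-zero : ∀ {n} (f : Fin n → Bool) → (∀ i → f i ≡ false) → sumGF2 f ≡ false
sum-zero {n} f f≡0 = trans (sum-cong-≗ f≡0) (sum-replicate-zero n)

sum-single : ∀ {n} (f : Fin n → Bool) k → (∀ i → i ≢ k → f i ≡ false) → sumGF2 f ≡ f k
sum-single {suc n} f zero    f≡0 =
  trans (cong (f zero xor_) (sum-zero _ λ i → f≡0 (suc i) λ ())) (𝔹.xor-identityʳ _)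
sum-single {suc n} f (suc k) f≡0 =
  trans (cong (_xor sumGF2 (f ∘ suc)) (f≡0 zero λ ()))
        (sum-single (f ∘ suc) k λ i i≢k → f≡0 (suc i) (i≢k ∘ 𝔽.suc-injective))

-- At column `g` a dependency reduces to the coefficient of the new row, which therefore vanishes;
-- the old rows do the rest. The other entries of the new row may be arbitrary, which
-- `Minor.extended` exploits.
extend-independent : ∀ {r n} (v : Fin (suc r) → Fin n → Bool) g → v zero g ≡ true → (∀ i → v (suc i) g ≡ false) →
                     LinearlyIndependent (v ∘ suc) → LinearlyIndependent v
extend-independent v g one zeros indep c eq = λ { zero → c₀≡0 ; (suc i) → tail i }
  where
  open ≡-Reasoning
  c₀≡0 : c zero ≡ false
  c₀≡0 = begin
    c zero                                   ≡⟨ 𝔹.∧-identityʳ _ ⟨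
    c zero ∧ true                            ≡⟨ cong (c zero ∧_) one ⟨
    c zero ∧ v zero g                        ≡⟨ sum-single (λ i → c i ∧ v i g) zero
                                                  (λ { zero 0≢0 → contradiction refl 0≢0
                                                     ; (suc i) _ → trans (cong (c (suc i) ∧_) (zeros i)) (𝔹.∧-zeroʳ _) }) ⟨
    sumGF2 (λ i → c i ∧ v i g)               ≡⟨ eq g ⟩
    false                                    ∎
  tail : ∀ i → c (suc i) ≡ false
  tail = indep (c ∘ suc) λ j →
    trans (cong (λ b → (b ∧ v zero j) xor sumGF2 (λ i → c (suc i) ∧ v (suc i) j)) (sym c₀≡0)) (eq j)

identity-independent : ∀ {r n} (v : Fin r → Fin n → Bool) (γ : Fin r → Fin n) →
                       (∀ i → v i (γ i) ≡ true) → (∀ i j → i ≢ j → v i (γ j) ≡ false) → LinearlyIndependent v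
identity-independent {zero}  v γ one zeros c eq ()
identity-independent {suc r} v γ one zeros =
  extend-independent v (γ zero) (one zero) (λ i → zeros (suc i) zero λ ())
    (identity-independent (v ∘ suc) (γ ∘ suc) (one ∘ suc) (λ i j i≢j → zeros (suc i) (suc j) (i≢j ∘ 𝔽.suc-injective)))

-- Two of the 2 ^ r subsets of the rows of x have the same sum; their
-- symmetric difference is a nontrivial dependency.
dependent : ∀ {r k} → k < r → (x : Fin r → Fin k → Bool) → ¬ LinearlyIndependent x
dependent {r} {k} k<r x indep = contradiction (bit-injective cᵢ≗cⱼ) i≢j
  where
  toBool : Fin 2 → Bool
  toBool zero       = false
  toBool (suc zero) = true
  toBool-injective : ∀ {a b} → toBool a ≡ toBool b → a ≡ b
  toBool-injective {zero}     {zero}     _ = refl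
  toBool-injective {zero}     {suc zero} ()
  toBool-injective {suc zero} {zero}     ()
  toBool-injective {suc zero} {suc zero} _ = refl
  fromBool : Bool → Fin 2
  fromBool false = zero
  fromBool true  = suc zero
  fromBool-injective : ∀ {a b} → fromBool a ≡ fromBool b → a ≡ b
  fromBool-injective {false} {false} _ = refl
  fromBool-injective {true}  {true}  _ = refl
  bit : Fin (2 ^ r) → Fin r → Bool
  bit e i = toBool (finToFun e i)
  bit-injective : ∀ {e f} → bit e ≗ bit f → e ≡ f
  bit-injective {e} {f} eq =
    trans (sym (𝔽.funToFin-finToFin {r} {2} e))
          (trans (funToFin-cong (λ i → toBool-injective (eq i))) (𝔽.funToFin-finToFin {r} {2} f))
    where
    funToFin-cong : ∀ {s} {g h : Fin s → Fin 2} → g ≗ h → funToFin g ≡ funToFin h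
    funToFin-cong {zero}  g≗h = refl
    funToFin-cong {suc s} g≗h = cong₂ combine (g≗h zero) (funToFin-cong (g≗h ∘ suc))
  combination : Fin (2 ^ r) → Fin k → Bool
  combination e l = sumGF2 (λ i → bit e i ∧ x i l)
  collision = 𝔽.pigeonhole (ℕ.^-monoʳ-< 2 (s<s z<s) k<r) (λ e → funToFin (fromBool ∘ combination e))
  i = proj₁ collision
  j = proj₁ (proj₂ collision)
  i≢j : i ≢ j
  i≢j = 𝔽.<⇒≢ (proj₁ (proj₂ (proj₂ collision)))
  same : ∀ l → combination i l ≡ combination j l
  same l = fromBool-injective (trans (sym (𝔽.finToFun-funToFin _ l))
    (trans (cong (λ z → finToFun z l) (proj₂ (proj₂ (proj₂ collision)))) (𝔽.finToFun-funToFin _ l)))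
  difference : ∀ l → sumGF2 (λ a → (bit i a xor bit j a) ∧ x a l) ≡ false
  difference l = begin
    sumGF2 (λ a → (bit i a xor bit j a) ∧ x a l)            ≡⟨ sum-cong-≗ (λ a → 𝔹.∧-distribʳ-xor (x a l) (bit i a) (bit j a)) ⟩
    sumGF2 (λ a → (bit i a ∧ x a l) xor (bit j a ∧ x a l))  ≡⟨ ∑-distrib-+ (λ a → bit i a ∧ x a l) (λ a → bit j a ∧ x a l) ⟩
    combination i l xor combination j l                     ≡⟨ cong (_xor combination j l) (same l) ⟩
    combination j l xor combination j l                     ≡⟨ 𝔹.xor-same (combination j l) ⟩
    false                                                   ∎
    where open ≡-Reasoning
  xor-false⇒≡ : ∀ {a b} → a xor b ≡ false → a ≡ b
  xor-false⇒≡ {false} {false} _ = refl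
  xor-false⇒≡ {true}  {true}  _ = refl
  cᵢ≗cⱼ : bit i ≗ bit j
  cᵢ≗cⱼ a = xor-false⇒≡ (indep (λ a → bit i a xor bit j a) difference a)

-- Independent rows of the product come from independent rows of the left factor, which has only `k`
-- columns.
factored-rank : ∀ {m n k} (X : Matrix m k) (Y : Matrix k n) r →
                IndependentRows (λ u v → sumGF2 (λ l → X u l ∧ Y l v)) r → r ≤ k
factored-rank X Y r (ρ , indep) = ℕ.≮⇒≥ λ k<r → dependent k<r (X ∘ ρ) λ c eq → indep c λ v → begin
    sumGF2 (λ i → c i ∧ sumGF2 (λ l → X (ρ i) l ∧ Y l v))    ≡⟨ sum-cong-≗ (λ i → *-distribˡ-sum (c i) (λ l → X (ρ i) l ∧ Y l v)) ⟩
    sumGF2 (λ i → sumGF2 (λ l → c i ∧ (X (ρ i) l ∧ Y l v)))  ≡⟨ ∑-comm (λ i l → c i ∧ (X (ρ i) l ∧ Y l v)) ⟩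
    sumGF2 (λ l → sumGF2 (λ i → c i ∧ (X (ρ i) l ∧ Y l v)))  ≡⟨ sum-cong-≗ (λ l → sum-cong-≗ (λ i → sym (𝔹.∧-assoc (c i) (X (ρ i) l) (Y l v)))) ⟩
    sumGF2 (λ l → sumGF2 (λ i → (c i ∧ X (ρ i) l) ∧ Y l v))  ≡⟨ sum-cong-≗ (λ l → sym (*-distribʳ-sum (Y l v) (λ i → c i ∧ X (ρ i) l))) ⟩
    sumGF2 (λ l → sumGF2 (λ i → c i ∧ X (ρ i) l) ∧ Y l v)    ≡⟨ sum-zero _ (λ l → cong (_∧ Y l v) (eq l)) ⟩
    false                                                    ∎
  where open ≡-Reasoning

HasRank-resp : ∀ {m n} {M N : Matrix m n} → (∀ u v → M u v ≡ N u v) → ∀ {r} → HasRank M r → HasRank N r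
HasRank-resp M≈N = IsMax-resp
  (λ (ρ , indep) → ρ , LinearlyIndependent-resp (λ i → M≈N (ρ i)) indep)
  (λ (ρ , indep) → ρ , LinearlyIndependent-resp (λ i j → sym (M≈N (ρ i) j)) indep)

∃-HasRank : ∀ {m n} (M : Matrix m n) → ∃ (HasRank M)
∃-HasRank {m} {n} M = greatest (IndependentRows M) (independentRows? M) n
  (λ r (ρ , indep) → ℕ.≮⇒≥ λ n<r → dependent n<r (M ∘ ρ) indep)
  (0 , (λ ()) , λ c eq ())

hasRank? : ∀ {m n} (M : Matrix m n) r → Dec (HasRank M r)
hasRank? M r with s , rank-s ← ∃-HasRank M =
  map′ (λ { refl → rank-s }) (IsMax-unique rank-s) (s ℕ.≟ r)

-- Counting

𝟙 : Bool → ℕ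
𝟙 b = if b then 1 else 0

count : ∀ {n} → (Fin n → Bool) → ℕ
count {zero}  p = 0
count {suc n} p = 𝟙 (p zero) + count (p ∘ suc)

count-cong : ∀ {n} {p q : Fin n → Bool} → p ≗ q → count p ≡ count q
count-cong {zero}  p≗q = refl
count-cong {suc n} p≗q = cong₂ _+_ (cong 𝟙 (p≗q zero)) (count-cong (p≗q ∘ suc))

_⊆ᵇ_ : ∀ {A : Set} → (A → Bool) → (A → Bool) → Set
p ⊆ᵇ q = ∀ x → p x ≡ true → q x ≡ true

𝟙-mono : ∀ {a b} → (a ≡ true → b ≡ true) → 𝟙 a ≤ 𝟙 b
𝟙-mono {false}         _ = z≤n
𝟙-mono {true}  {true}  _ = ℕ.≤-refl
𝟙-mono {true}  {false} f = contradiction (f refl) λ ()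

count-mono : ∀ {n} {p q : Fin n → Bool} → p ⊆ᵇ q → count p ≤ count q
count-mono {zero}  p⊆q = z≤n
count-mono {suc n} p⊆q = ℕ.+-mono-≤ (𝟙-mono (p⊆q zero)) (count-mono (p⊆q ∘ suc))

count-strict : ∀ {n} {p q : Fin n → Bool} → p ⊆ᵇ q → ∀ x → q x ≡ true → p x ≡ false → count p < count q
count-strict p⊆q zero    qx px rewrite qx | px = s≤s (count-mono (p⊆q ∘ suc))
count-strict p⊆q (suc x) qx px = ℕ.+-mono-≤-< (𝟙-mono (p⊆q zero)) (count-strict (p⊆q ∘ suc) x qx px)

count-const : ∀ n b → count {n} (λ _ → b) ≡ n * 𝟙 b
count-const zero    b = refl
count-const (suc n) b = cong (𝟙 b +_) (count-const n b)

count-true : ∀ n → count {n} (λ _ → true) ≡ n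
count-true n = trans (count-const n true) (ℕ.*-identityʳ n)

count-false : ∀ n → count {n} (λ _ → false) ≡ 0
count-false n = trans (count-const n false) (ℕ.*-zeroʳ n)

count≤n : ∀ {n} (p : Fin n → Bool) → count p ≤ n
count≤n {n} p = subst (count p ≤_) (count-true n) (count-mono {p = p} λ _ _ → refl)

count-∨ : ∀ {n} (p q : Fin n → Bool) → count (λ x → p x ∨ q x) ≤ count p + count q
count-∨ {zero}  p q = z≤n
count-∨ {suc n} p q = begin
  𝟙 (p zero ∨ q zero) + count (λ x → p (suc x) ∨ q (suc x))              ≤⟨ ℕ.+-mono-≤ (𝟙-∨ (p zero) (q zero)) (count-∨ (p ∘ suc) (q ∘ suc)) ⟩
  (𝟙 (p zero) + 𝟙 (q zero)) + (count (p ∘ suc) + count (q ∘ suc))        ≡⟨ interchange (𝟙 (p zero)) _ _ _ ⟩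
  (𝟙 (p zero) + count (p ∘ suc)) + (𝟙 (q zero) + count (q ∘ suc))        ∎
  where
  open ℕ.≤-Reasoning
  𝟙-∨ : ∀ a b → 𝟙 (a ∨ b) ≤ 𝟙 a + 𝟙 b
  𝟙-∨ false b = ℕ.≤-refl
  𝟙-∨ true  b = s≤s z≤n
  interchange : ∀ a b c d → (a + b) + (c + d) ≡ (a + c) + (b + d)
  interchange = solve-∀

count-not : ∀ {n} (p : Fin n → Bool) → count p + count (not ∘ p) ≡ n
count-not {zero}  p = refl
count-not {suc n} p with p zero
... | true  = cong suc (count-not (p ∘ suc))
... | false = trans (ℕ.+-suc _ _) (cong suc (count-not (p ∘ suc)))

count-+ : ∀ m {n} (p : Fin (m + n) → Bool) → count p ≡ count (λ i → p (i ↑ˡ n)) + count (λ j → p (m ↑ʳ j))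
count-+ zero    p = refl
count-+ (suc m) p = trans (cong (𝟙 (p zero) +_) (count-+ m (p ∘ suc))) (sym (ℕ.+-assoc (𝟙 (p zero)) _ _))

count-× : ∀ m {n} (p : Fin (m * n) → Bool) (q : Fin m → Bool) (r : Fin n → Bool) →
          (∀ i j → p (combine i j) ≡ q i ∧ r j) → count p ≡ count q * count r
count-× zero        p q r p≡q∧r = refl
count-× (suc m) {n} p q r p≡q∧r = begin
  count p                                                       ≡⟨ count-+ n p ⟩
  count (λ j → p (j ↑ˡ (m * n))) + count (λ x → p (n ↑ʳ x))     ≡⟨ cong₂ _+_ (trans (count-cong (p≡q∧r zero)) (row (q zero)))
                                                                             (count-× m _ (q ∘ suc) r (p≡q∧r ∘ suc)) ⟩
  𝟙 (q zero) * count r + count (q ∘ suc) * count r              ≡⟨ ℕ.*-distribʳ-+ (count r) (𝟙 (q zero)) _ ⟨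
  count q * count r                                             ∎
  where
  open ≡-Reasoning
  row : ∀ b → count (λ j → b ∧ r j) ≡ 𝟙 b * count r
  row true  = sym (ℕ.*-identityˡ _)
  row false = count-false n

∣∣≡count : ∀ {n} (C : Subset n) → ∣ C ∣ ≡ count (Vec.lookup C)
∣∣≡count []          = refl
∣∣≡count (true ∷ C)  = cong suc (∣∣≡count C)
∣∣≡count (false ∷ C) = ∣∣≡count C

∈⇒lookup : ∀ {n} {C : Subset n} {x} → x ∈ C → Vec.lookup C x ≡ true
∈⇒lookup = 𝕍.[]=⇒lookup

lookup⇒∈ : ∀ {n} {C : Subset n} {x} → Vec.lookup C x ≡ true → x ∈ C
lookup⇒∈ {C = C} {x} = 𝕍.lookup⇒[]= x C

enumerate : ∀ {n} (p : Fin n → Bool) → Σ (Fin (count p) → Fin n) λ f →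
  (∀ {i j} → f i ≡ f j → i ≡ j) × (∀ i → p (f i) ≡ true) × (∀ x → p x ≡ true → ∃ λ i → f i ≡ x)
enumerate {zero}  p = (λ ()) , (λ {i} → λ { {()} }) , (λ ()) , λ ()
enumerate {suc n} p with p zero in p₀ | enumerate (p ∘ suc)
... | false | f , inj , mem , sur =
  suc ∘ f , inj ∘ 𝔽.suc-injective , mem , λ { zero px → contradiction (trans (sym p₀) px) λ ()
                                            ; (suc x) px → let i , eq = sur x px in i , cong suc eq }
... | true | f , inj , mem , sur = g , g-inj , g-mem , g-sur
  where
  g : Fin (suc (count (p ∘ suc))) → Fin (suc n)
  g zero    = zero
  g (suc i) = suc (f i)
  g-inj : ∀ {i j} → g i ≡ g j → i ≡ j
  g-inj {zero}  {zero}  _  = refl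
  g-inj {suc i} {suc j} eq = cong suc (inj (𝔽.suc-injective eq))
  g-mem : ∀ i → p (g i) ≡ true
  g-mem zero    = p₀
  g-mem (suc i) = mem i
  g-sur : ∀ x → p x ≡ true → ∃ λ i → g i ≡ x
  g-sur zero    _  = zero , refl
  g-sur (suc x) px = let i , eq = sur x px in suc i , cong suc eq

choose : ∀ {n m} (p : Fin n → Bool) → m ≤ count p → Σ (Fin m → Fin n) λ f →
  (∀ {i j} → f i ≡ f j → i ≡ j) × (∀ i → p (f i) ≡ true)
choose p m≤p = let f , inj , mem , _ = enumerate p in
  (λ i → f (inject≤ i m≤p)) , (λ eq → 𝔽.inject≤-injective m≤p m≤p _ _ (inj eq)) , λ i → mem _

does-true : ∀ {A : Set} {d : Dec A} → does d ≡ true → A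
does-true {d = yes a} _ = a

∧-true : ∀ {a b} → a ∧ b ≡ true → a ≡ true × b ≡ true
∧-true {true} {true} _ = refl , refl

∨-true : ∀ {a b} → a ∨ b ≡ true → a ≡ true ⊎ b ≡ true
∨-true {true}  _ = inj₁ refl
∨-true {false} b = inj₂ b

count-≟ : ∀ {n} (y : Fin n) → count (λ x → does (x 𝔽.≟ y)) ≤ 1
count-≟ {suc n} zero    = s≤s (ℕ.≤-reflexive (count-false n))
count-≟ {suc n} (suc y) = count-≟ y

-- By `count-≟`, each forbidden value costs at most one element of `p`.
chooseAvoiding : ∀ {n m} j (κ : Fin j → Fin n) (p : Fin n → Bool) → j + m ≤ count p → Σ (Fin m → Fin n) λ f →
  (∀ {i j} → f i ≡ f j → i ≡ j) × (∀ i → p (f i) ≡ true) × (∀ i l → f i ≢ κ l)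
chooseAvoiding zero κ p m≤p = let f , inj , mem = choose p m≤p in f , inj , mem , λ _ ()
chooseAvoiding {m = m} (suc j) κ p j+m<p =
  let f , inj , mem , avoid = chooseAvoiding j (κ ∘ suc) p′ (s≤s⁻¹ (ℕ.≤-trans j+m<p bound)) in
  f , inj , (λ i → proj₁ (∧-true {p (f i)} (mem i))) , λ
    { i zero eq → contradiction (trans (sym (dec-true (f i 𝔽.≟ κ zero) eq)) (not-true (proj₂ (∧-true {p (f i)} (mem i))))) λ ()
    ; i (suc l) → avoid i l }
  where
  not-true : ∀ {b} → not b ≡ true → b ≡ false
  not-true {false} _ = refl
  e p′ : _ → Bool
  e x = does (x 𝔽.≟ κ zero)
  p′ x = p x ∧ not (e x)
  split : ∀ a b → a ≡ true → (b ∨ (a ∧ not b)) ≡ true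
  split true true  _ = refl
  split true false _ = refl
  bound : count p ≤ suc (count p′)
  bound = ℕ.≤-trans (count-mono {q = λ x → e x ∨ p′ x} (λ x → split (p x) (e x)))
            (ℕ.≤-trans (count-∨ e p′) (ℕ.+-monoˡ-≤ (count p′) (count-≟ (κ zero))))

-- Connectivity

_≈ᴳ_ : ∀ {n} → Graph n → Graph n → Set
G ≈ᴳ H = ∀ u v → adj G u v ≡ adj H u v

module Reachability {n} (G : Graph n) (u : Fin n) where
  grow? : (p : Fin n → Bool) (v : Fin n) → Dec (∃ λ w → p w ≡ true × adj G w v ≡ true)
  grow? p v = 𝔽.any? λ w → (p w 𝔹.≟ true) ×-dec (adj G w v 𝔹.≟ true)

  ball : ℕ → Fin n → Bool
  ball zero    v = does (u 𝔽.≟ v)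
  ball (suc m) v = ball m v ∨ does (grow? (ball m) v)

  sound : ∀ m {v} → ball m v ≡ true → Star (Edge G) u v
  sound zero    {v} b with refl ← does-true {d = u 𝔽.≟ v} b = ε
  sound (suc m) {v} b with ∨-true {ball m v} b
  ... | inj₁ old = sound m old
  ... | inj₂ new with w , bw , wv ← does-true {d = grow? (ball m) v} new = sound m bw ◅◅ (wv ◅ ε)

  centre : ∀ m → ball m u ≡ true
  centre zero    = dec-true (u 𝔽.≟ u) refl
  centre (suc m) = cong (_∨ does (grow? (ball m) u)) (centre m)

  Escape : ℕ → Set
  Escape m = ∃ λ v → ball m v ≡ false × ∃ λ w → ball m w ≡ true × adj G w v ≡ true

  escape? : ∀ m → Dec (Escape m)
  escape? m = 𝔽.any? λ v → (ball m v 𝔹.≟ false) ×-dec grow? (ball m) v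

  -- While some edge leaves the ball, the next ball is strictly larger. Taken at `n`, the second
  -- alternative is impossible, so some ball is closed.
  saturates : ∀ m → (∃ λ j → ¬ Escape j) ⊎ m < count (ball m)
  saturates zero = inj₂ (subst (_< count (ball 0)) (count-false n)
                          (count-strict {p = λ _ → false} (λ _ ()) u (centre 0) refl))
  saturates (suc m) with saturates m | escape? m
  ... | inj₁ closed | _     = inj₁ closed
  ... | inj₂ _      | no ¬e = inj₁ (m , ¬e)
  ... | inj₂ m<b    | yes (v , out , w) = inj₂ (ℕ.≤-trans (s≤s m<b)
    (count-strict (λ x b → cong (_∨ does (grow? (ball m) x)) b) v
      (trans (cong (_∨ does (grow? (ball m) v)) out) (dec-true (grow? (ball m) v) w)) out))

  complete : ∀ j → ¬ Escape j → ∀ {v w} → ball j v ≡ true → Star (Edge G) v w → ball j w ≡ true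
  complete j ¬e b ε = b
  complete j ¬e {v} b (_◅_ {j = x} vx path) with ball j x in bx
  ... | true  = complete j ¬e bx path
  ... | false = contradiction (x , bx , v , b , vx) ¬e

  reach? : ∀ v → Dec (Star (Edge G) u v)
  reach? v with saturates n
  ... | inj₁ (j , ¬e) = map′ (sound j) (complete j ¬e (centre j)) (ball j v 𝔹.≟ true)
  ... | inj₂ n<b = contradiction n<b (ℕ.≤⇒≯ (count≤n (ball n)))

open Reachability using (reach?)

edge-sym : ∀ {n} (G : Graph n) {u v} → Edge G u v → Edge G v u
edge-sym G {u} {v} e = trans (symmetric G v u) e

path-sym : ∀ {n} (G : Graph n) {u v} → Star (Edge G) u v → Star (Edge G) v u
path-sym G ε        = ε
path-sym G (e ◅ es) = path-sym G es ◅◅ (edge-sym G e ◅ ε)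

component : ∀ {n} → Graph n → Fin n → Subset n
component G v = Vec.tabulate λ w → does (reach? G v w)

∈component : ∀ {n} (G : Graph n) {v w} → w ∈ component G v → Star (Edge G) v w
∈component G {v} {w} w∈ =
  does-true {d = reach? G v w} (trans (sym (𝕍.lookup∘tabulate _ w)) (∈⇒lookup w∈))

component∋ : ∀ {n} (G : Graph n) {v w} → Star (Edge G) v w → w ∈ component G v
component∋ G {v} {w} path = lookup⇒∈ (trans (𝕍.lookup∘tabulate _ w) (dec-true (reach? G v w) path))

component-isComponent : ∀ {n} (G : Graph n) v → IsComponent G (component G v)
component-isComponent G v = (v , component∋ G ε) , λ u w u∈ →
  mk⇔ (λ w∈ → path-sym G (∈component G u∈) ◅◅ ∈component G w∈)
      (λ path → component∋ G (∈component G u∈ ◅◅ path))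

isComponent? : ∀ {n} (G : Graph n) C → Dec (IsComponent G C)
isComponent? G C = 𝕊.nonempty? C ×-dec 𝔽.all? λ u → 𝔽.all? λ v → (u 𝕊.∈? C) →-dec
  map′ (λ (f , g) → mk⇔ f g) (λ e → Equivalence.to e , Equivalence.from e)
    (((v 𝕊.∈? C) →-dec reach? G u v) ×-dec (reach? G u v →-dec (v 𝕊.∈? C)))

path-resp : ∀ {n} {G H : Graph n} → G ≈ᴳ H → ∀ {u v} → Star (Edge G) u v → Star (Edge H) u v
path-resp G≈H ε        = ε
path-resp {G = G} {H} G≈H (e ◅ es) = trans (sym (G≈H _ _)) e ◅ path-resp {G = G} {H} G≈H es

≈ᴳ-sym : ∀ {n} {G H : Graph n} → G ≈ᴳ H → H ≈ᴳ G
≈ᴳ-sym G≈H u v = sym (G≈H u v)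

IsComponent-resp : ∀ {n} {G H : Graph n} → G ≈ᴳ H → ∀ {C} → IsComponent G C → IsComponent H C
IsComponent-resp {G = G} {H} G≈H (ne , comp) = ne , λ u v u∈ →
  mk⇔ (path-resp {G = G} {H} G≈H ∘ Equivalence.to (comp u v u∈))
      (Equivalence.from (comp u v u∈) ∘ path-resp {G = H} {G} (≈ᴳ-sym {G = G} {H} G≈H))

ComponentSize : ∀ {n} → Graph n → ℕ → Set
ComponentSize G m = ∃[ C ] (IsComponent G C × ∣ C ∣ ≡ m)

componentSize? : ∀ {n} (G : Graph n) m → Dec (ComponentSize G m)
componentSize? G m = 𝕊.anySubset? λ C → isComponent? G C ×-dec (∣ C ∣ ℕ.≟ m)

MaxComponentSize-resp : ∀ {n} {G H : Graph n} → G ≈ᴳ H → ∀ {s} → MaxComponentSize G s → MaxComponentSize H s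
MaxComponentSize-resp {G = G} {H} G≈H = Sum.map₂ (IsMax-resp
  (λ (C , comp , size) → C , IsComponent-resp {G = G} {H} G≈H comp , size)
  (λ (C , comp , size) → C , IsComponent-resp {G = H} {G} (≈ᴳ-sym {G = G} {H} G≈H) comp , size))

∃-MaxComponentSize : ∀ {n} (G : Graph n) → ∃ (MaxComponentSize G)
∃-MaxComponentSize {zero}  G = 0 , inj₁ (refl , refl)
∃-MaxComponentSize {suc n} G =
  let s , max = greatest (ComponentSize G) (componentSize? G) (suc n)
                  (λ { j (C , _ , refl) → 𝕊.∣p∣≤n C })
                  (_ , component G zero , component-isComponent G zero , refl)
  in s , inj₂ max

MaxComponentSize-unique : ∀ {n} {G : Graph n} {a b} → MaxComponentSize G a → MaxComponentSize G b → a ≡ b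
MaxComponentSize-unique (inj₁ (_ , refl))  (inj₁ (_ , refl)) = refl
MaxComponentSize-unique (inj₁ (refl , _))  (inj₂ ((_ , ((() , _) , _) , _) , _))
MaxComponentSize-unique (inj₂ ((_ , ((() , _) , _) , _) , _)) (inj₁ (refl , _))
MaxComponentSize-unique (inj₂ a) (inj₂ b) = IsMax-unique a b

-- Existence of the rank integrity

fillDiagonal-resp : ∀ {n} {G H : Graph n} {d e : Fin n → Bool} → G ≈ᴳ H → d ≗ e →
                    ∀ u v → fillDiagonal G d u v ≡ fillDiagonal H e u v
fillDiagonal-resp G≈H d≗e u v with does (u 𝔽.≟ v)
... | true  = d≗e u
... | false = G≈H u v

DiagonalRank : ∀ {n} → Graph n → ℕ → Set
DiagonalRank {n} G r = Σ (Fin n → Bool) λ d → HasRank (fillDiagonal G d) r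

diagonalRank? : ∀ {n} (G : Graph n) r → Dec (DiagonalRank G r)
diagonalRank? G r = search-→ refl search-Bool (λ d → HasRank (fillDiagonal G d) r)
  (λ d≗e → HasRank-resp (fillDiagonal-resp {G = G} {G} (λ _ _ → refl) d≗e))
  (λ d → hasRank? (fillDiagonal G d) r)

MinimumRank-resp : ∀ {n} {G H : Graph n} → G ≈ᴳ H → ∀ {r} → MinimumRank G r → MinimumRank H r
MinimumRank-resp {G = G} {H} G≈H = IsMin-resp
  (λ (d , rank) → d , HasRank-resp (fillDiagonal-resp {G = G} {H} {d} {d} G≈H λ _ → refl) rank)
  (λ (d , rank) → d , HasRank-resp (fillDiagonal-resp {G = H} {G} {d} {d} (≈ᴳ-sym {G = G} {H} G≈H) λ _ → refl) rank)

∃-MinimumRank≤ : ∀ {n} (G : Graph n) d {r} → HasRank (fillDiagonal G d) r → ∃ λ m → MinimumRank G m × m ≤ r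
∃-MinimumRank≤ G d {r} rank = least (DiagonalRank G) (diagonalRank? G) r (d , rank)

search-Graph : ∀ {n} → Search (Graph n) _≈ᴳ_
search-Graph {n} P resp P? =
  map′ (λ (_ , s , l , p) → record { symmetric = s ; loopless = l } , p)
       (λ (G , p) → adj G , symmetric G , loopless G , p)
       (search-→ (λ _ → refl) (search-→ refl search-Bool) Q Q-resp Q?)
  where
  Q : (Fin n → Fin n → Bool) → Set
  Q a = Σ (∀ u v → a u v ≡ a v u) λ s → Σ (∀ v → a v v ≡ false) λ l →
        P (record { adj = a ; symmetric = s ; loopless = l })
  Q-resp : ∀ {a b} → (∀ u v → a u v ≡ b u v) → Q a → Q b
  Q-resp a≈b (s , l , p) =
    (λ u v → trans (sym (a≈b u v)) (trans (s u v) (a≈b v u))) , (λ v → trans (sym (a≈b v v)) (l v)) , resp a≈b p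
  Q? : ∀ a → Dec (Q a)
  Q? a with 𝔽.all? (λ u → 𝔽.all? λ v → a u v 𝔹.≟ a v u) | 𝔽.all? (λ v → a v v 𝔹.≟ false)
  ... | no ¬s | _     = no λ (s , _) → ¬s s
  ... | yes _ | no ¬l = no λ (_ , l , _) → ¬l l
  -- Graphs with this matrix may differ in their proofs of symmetry and looplessness; `resp` carries
  -- `P` from one to the other.
  ... | yes s | yes l = map′ (λ p → s , l , p) (λ (_ , _ , p) → resp (λ _ _ → refl) p) (P? _)

module _ {n} (G : Graph n) (k : ℕ) where
  LowRank : Graph n → Set
  LowRank G′ = ∃[ r ] (MinimumRank (G ⊕ G′) r × r ≤ k)

  minimumRank : ∀ G′ → ∃ (MinimumRank (G ⊕ G′))
  minimumRank G′ =
    let r , rank = ∃-HasRank (fillDiagonal (G ⊕ G′) (λ _ → false))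
        m , min , _ = ∃-MinimumRank≤ (G ⊕ G′) (λ _ → false) rank
    in m , min

  lowRank? : ∀ G′ → Dec (LowRank G′)
  lowRank? G′ with m , min ← minimumRank G′ =
    map′ (λ m≤k → m , min , m≤k)
         (λ (r , min-r , r≤k) → subst (_≤ k) (IsMin-unique min-r min) r≤k)
         (m ℕ.≤? k)

  maxComponentSize? : ∀ (G′ : Graph n) s → Dec (MaxComponentSize G′ s)
  maxComponentSize? G′ s with s′ , max ← ∃-MaxComponentSize G′ =
    map′ (λ { refl → max }) (MaxComponentSize-unique {G = G′} max) (s′ ℕ.≟ s)

  Attains : ℕ → Set
  Attains s = Σ (Graph n) λ G′ → LowRank G′ × MaxComponentSize G′ s

  attains? : ∀ s → Dec (Attains s)
  attains? s = search-Graph (λ G′ → LowRank G′ × MaxComponentSize G′ s)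
    (λ {G₁} {G₂} G₁≈G₂ ((r , min , r≤k) , max) →
      (r , MinimumRank-resp {G = G ⊕ G₁} {G ⊕ G₂} (λ u v → cong (adj G u v xor_) (G₁≈G₂ u v)) min , r≤k) ,
      MaxComponentSize-resp {G = G₁} {G₂} G₁≈G₂ max)
    (λ G′ → lowRank? G′ ×-dec maxComponentSize? G′ s)

  -- Bounds in place of exact extrema, for one filling of the diagonal and all components. The
  -- combinatorial argument works with this form; `rankIntegrity≤-intro` pays for it by locating the
  -- minimum through search.
  RankIntegrity≤ : ℕ → Set
  RankIntegrity≤ t = Σ (Graph n) λ G′ →
    (∃ λ d → ∀ r → IndependentRows (fillDiagonal (G ⊕ G′) d) r → r ≤ k) ×
    (∀ C → IsComponent G′ C → ∣ C ∣ ≤ t)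

  rankIntegrity≤-intro : ∀ {t} → RankIntegrity≤ t → ∃[ s ] (RankIntegrity G k s × s ≤ t)
  rankIntegrity≤-intro {t} (G′ , (d , rank≤) , small) =
    let r , rank = ∃-HasRank (fillDiagonal (G ⊕ G′) d)
        m , min , m≤r = ∃-MinimumRank≤ (G ⊕ G′) d rank
        s , max = ∃-MaxComponentSize G′
        s′ , integrity , s′≤s = least Attains attains? s (G′ , (m , min , ℕ.≤-trans m≤r (rank≤ r (proj₁ rank))) , max)
    in s′ , integrity , ℕ.≤-trans s′≤s (max≤t max)
    where
    max≤t : ∀ {s} → MaxComponentSize G′ s → s ≤ t
    max≤t (inj₁ (_ , refl)) = z≤n
    max≤t (inj₂ ((C , comp , refl) , _)) = small C comp

  rankIntegrity≤-elim : ∀ {t} → ∃[ s ] (RankIntegrity G k s × s ≤ t) → RankIntegrity≤ t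
  rankIntegrity≤-elim {t} (s , ((G′ , (r , ((d , rank) , _) , r≤k) , max) , _) , s≤t) =
    G′ , (d , λ j rows → ℕ.≤-trans (proj₂ rank j rows) r≤k) , λ C comp → ℕ.≤-trans (≤max max C comp) s≤t
    where
    ≤max : MaxComponentSize G′ s → ∀ C → IsComponent G′ C → ∣ C ∣ ≤ s
    ≤max (inj₁ (refl , _)) C ((() , _) , _)
    ≤max (inj₂ (_ , max)) C comp = max ∣ C ∣ (C , comp , refl)

-- Balanced cuts

-- Collect components until q vertices are covered; if the last component
-- overshoots, then it is itself one side of a balanced cut.
module BalancedCut {N} (G : Graph N) (q : ℕ) (3q≤N : q + (q + q) ≤ N)
                   (small : ∀ C → IsComponent G C → ∣ C ∣ ≤ N ∸ q) where

  Balanced : (Fin N → Bool) → Set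
  Balanced S = (∀ u v → Edge G u v → S u ≡ S v) × q ≤ count S × q ≤ count (not ∘ S)

  class : Fin N → Fin N → Bool
  class u v = does (reach? G u v)

  class-closed : ∀ i u v → Edge G u v → class i u ≡ class i v
  class-closed i u v e with reach? G i u | reach? G i v
  ... | yes _ | yes _ = refl
  ... | no  _ | no  _ = refl
  ... | yes p | no ¬p = contradiction (p ◅◅ (e ◅ ε)) ¬p
  ... | no ¬p | yes p = contradiction (p ◅◅ (edge-sym G e ◅ ε)) ¬p

  class-small : ∀ i → count (class i) ≤ N ∸ q
  class-small i = subst (_≤ N ∸ q)
    (trans (∣∣≡count (component G i)) (count-cong (𝕍.lookup∘tabulate (class i))))
    (small (component G i) (component-isComponent G i))

  covered : List (Fin N) → Fin N → Bool
  covered []       v = false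
  covered (i ∷ is) v = class i v ∨ covered is v

  covered-closed : ∀ is u v → Edge G u v → covered is u ≡ covered is v
  covered-closed []       u v e = refl
  covered-closed (i ∷ is) u v e = cong₂ _∨_ (class-closed i u v e) (covered-closed is u v e)

  q≤N : q ≤ N
  q≤N = ℕ.≤-trans (ℕ.m≤m+n q (q + q)) 3q≤N

  class-balanced : ∀ i → q ≤ count (class i) → Balanced (class i)
  class-balanced i large = class-closed i , large , ℕ.+-cancelˡ-≤ (N ∸ q) q _ (begin
    N ∸ q + q                                ≡⟨ ℕ.m∸n+n≡m q≤N ⟩
    N                                        ≡⟨ count-not (class i) ⟨
    count (class i) + count (not ∘ class i)  ≤⟨ ℕ.+-monoˡ-≤ _ (class-small i) ⟩
    N ∸ q + count (not ∘ class i)            ∎)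
    where open ℕ.≤-Reasoning

  -- Fewer than `q` vertices were covered before and fewer than `q` remain uncovered; all others lie
  -- in the last class, and `3q≤N` leaves at least `q` of them.
  class-large : ∀ i is → count (covered is) < q → count (not ∘ covered (i ∷ is)) < q → q ≤ count (class i)
  class-large i is before after = ℕ.+-cancelʳ-≤ (q + q) q (count (class i)) (begin
    q + (q + q)                                                             ≤⟨ 3q≤N ⟩
    N                                                                       ≡⟨ count-not (covered (i ∷ is)) ⟨
    count (covered (i ∷ is)) + count (not ∘ covered (i ∷ is))               ≤⟨ ℕ.+-monoˡ-≤ _ (count-∨ (class i) (covered is)) ⟩
    (count (class i) + count (covered is)) + count (not ∘ covered (i ∷ is)) ≡⟨ ℕ.+-assoc (count (class i)) _ _ ⟩
    count (class i) + (count (covered is) + count (not ∘ covered (i ∷ is))) ≤⟨ ℕ.+-monoʳ-≤ (count (class i)) (ℕ.+-mono-≤ (ℕ.<⇒≤ before) (ℕ.<⇒≤ after)) ⟩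
    count (class i) + (q + q)                                               ∎)
    where open ℕ.≤-Reasoning

  collect : ∀ is → count (covered is) < q ⊎ ∃ Balanced
  collect [] with 0 ℕ.<? q
  ... | yes 0<q = inj₁ (subst (_< q) (sym (count-false N)) 0<q)
  -- `quota 0` is 0: for `k` equal to 0 the empty set is already one side of a balanced cut.
  ... | no  0≮q = inj₂ ((λ _ → false) , (λ _ _ _ → refl) , q≤ _ , q≤ _)
    where
    q≤ : ∀ m → q ≤ m
    q≤ m = ℕ.≤-trans (ℕ.≮⇒≥ 0≮q) z≤n
  collect (i ∷ is) with collect is
  ... | inj₂ cut = inj₂ cut
  ... | inj₁ before with count (covered (i ∷ is)) ℕ.<? q | count (not ∘ covered (i ∷ is)) ℕ.<? q
  ...   | yes fewer | _         = inj₁ fewer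
  ...   | no  q≤in  | no  q≤out = inj₂ (covered (i ∷ is) , covered-closed (i ∷ is) , ℕ.≮⇒≥ q≤in , ℕ.≮⇒≥ q≤out)
  ...   | no  _     | yes after = inj₂ (class i , class-balanced i (class-large i is before after))

  covers : ∀ {is} v → v ∈ˡ is → covered is v ≡ true
  covers {_ ∷ is} v (here refl) = cong (_∨ covered is v) (dec-true (reach? G v v) ε)
  covers {i ∷ is} v (there v∈)  = trans (cong (class i v ∨_) (covers v v∈)) (𝔹.∨-zeroʳ _)

  balancedCut : ∃ Balanced
  balancedCut with collect (List.allFin N)
  ... | inj₂ cut = cut
  ... | inj₁ few = contradiction (ℕ.≤-trans few q≤N)
    (ℕ.<-irrefl (trans (count-cong (λ v → covers v (∈-allFin v))) (count-true N)))

-- The gadget graph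

-- Every vertex (a , inj₁ a) is a hub.  All other vertices are adjacent to hubs
-- only: (a , inj₁ b) to a and b, (a , inj₂ (inj₁ b)) to a and b if good a b and
-- to all hubs otherwise, and the pendant (a , inj₂ (inj₂ w)) to a.
module Gadget (P W : ℕ) (good : Fin P → Fin P → Bool) where

  L N : ℕ
  L = P + (P + W)
  N = P * L

  Layer V : Set
  Layer = Fin P ⊎ Fin P ⊎ Fin W
  V = Fin P × Layer

  layer : Fin L → Layer
  layer b = Sum.map₂ (splitAt P) (splitAt P b)

  unlayer : Layer → Fin L
  unlayer l = join P (P + W) (Sum.map₂ (join P W) l)

  layer-unlayer : ∀ l → layer (unlayer l) ≡ l
  layer-unlayer l = trans (cong (Sum.map₂ (splitAt P)) (𝔽.splitAt-join P (P + W) (Sum.map₂ (join P W) l))) (undo l)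
    where
    undo : ∀ l → Sum.map₂ (splitAt P) (Sum.map₂ (join P W) l) ≡ l
    undo (inj₁ _) = refl
    undo (inj₂ m) = cong inj₂ (𝔽.splitAt-join P W m)

  unlayer-layer : ∀ b → unlayer (layer b) ≡ b
  unlayer-layer b = trans (cong (join P (P + W)) (undo (splitAt P b))) (𝔽.join-splitAt P (P + W) b)
    where
    undo : ∀ s → Sum.map₂ (join P W) (Sum.map₂ (splitAt P) s) ≡ s
    undo (inj₁ _) = refl
    undo (inj₂ m) = cong inj₂ (𝔽.join-splitAt P W m)

  vertex : Fin N → V
  vertex x = proj₁ (remQuot {P} L x) , layer (proj₂ (remQuot {P} L x))

  index : V → Fin N
  index (a , l) = combine a (unlayer l)

  vertex-combine : ∀ a b → vertex (combine a b) ≡ (a , layer b)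
  vertex-combine a b = cong (λ (a , b) → a , layer b) (𝔽.remQuot-combine a b)

  vertex-index : ∀ x → vertex (index x) ≡ x
  vertex-index (a , l) = trans (vertex-combine a (unlayer l)) (cong (a ,_) (layer-unlayer l))

  index-vertex : ∀ x → index (vertex x) ≡ x
  index-vertex x = trans (cong (combine {P} _) (unlayer-layer _)) (𝔽.combine-remQuot {P} L x)

  count-V : ∀ (f : V → Bool) (p : Fin P → Bool) (r : Layer → Bool) → (∀ a l → f (a , l) ≡ p a ∧ r l) →
            count (f ∘ vertex) ≡ count p * (count (r ∘ inj₁) + (count (r ∘ inj₂ ∘ inj₁) + count (r ∘ inj₂ ∘ inj₂)))
  count-V f p r f≡ = trans
    (count-× P (f ∘ vertex) p (r ∘ layer) λ a b → trans (cong f (vertex-combine a b)) (f≡ a (layer b)))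
    (cong (count p *_) layers)
    where
    layers : count (r ∘ layer) ≡ count (r ∘ inj₁) + (count (r ∘ inj₂ ∘ inj₁) + count (r ∘ inj₂ ∘ inj₂))
    layers = trans (count-+ P (r ∘ layer)) (cong₂ _+_
      (count-cong λ i → cong (r ∘ Sum.map₂ (splitAt P)) (𝔽.splitAt-↑ˡ P i (P + W)))
      (trans (count-cong λ j → cong (r ∘ Sum.map₂ (splitAt P)) (𝔽.splitAt-↑ʳ P (P + W) j))
        (trans (count-+ P (r ∘ inj₂ ∘ splitAt P)) (cong₂ _+_
          (count-cong λ i → cong (r ∘ inj₂) (𝔽.splitAt-↑ˡ P i W))
          (count-cong λ j → cong (r ∘ inj₂) (𝔽.splitAt-↑ʳ P W j))))))

  hub : Fin P → V
  hub a = a , inj₁ a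

  isHub : V → Bool
  isHub (a , inj₁ b) = does (a 𝔽.≟ b)
  isHub (a , inj₂ _) = false

  attached : V → Fin P → Bool
  attached (a , inj₁ b)        h = does (h 𝔽.≟ a) ∨ does (h 𝔽.≟ b)
  attached (a , inj₂ (inj₁ b)) h = (does (h 𝔽.≟ a) ∨ does (h 𝔽.≟ b)) ∨ not (good a b)
  attached (a , inj₂ (inj₂ _)) h = does (h 𝔽.≟ a)

  -- Oriented from hub to non-hub. This makes `H` bipartite and masks the values that `attached`
  -- takes at hubs.
  fromHub : V → V → Bool
  fromHub x y = isHub x ∧ (not (isHub y) ∧ attached y (proj₁ x))

  adjV : V → V → Bool
  adjV x y = fromHub x y ∨ fromHub y x

  H : Graph N
  H .adj x y       = adjV (vertex x) (vertex y)
  H .symmetric x y = 𝔹.∨-comm (fromHub (vertex x) (vertex y)) _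
  H .loopless x    = irreflexive (isHub (vertex x)) _
    where
    irreflexive : ∀ a b → (a ∧ (not a ∧ b)) ∨ (a ∧ (not a ∧ b)) ≡ false
    irreflexive true  b = refl
    irreflexive false b = refl

  isHub-hub : ∀ h → isHub (hub h) ≡ true
  isHub-hub h = dec-true (h 𝔽.≟ h) refl

  isHub⇒hub : ∀ x → isHub x ≡ true → x ≡ hub (proj₁ x)
  isHub⇒hub (a , inj₁ b) eq with refl ← does-true {d = a 𝔽.≟ b} eq = refl

  isHub-≢ : ∀ {a b} → a ≢ b → isHub (a , inj₁ b) ≡ false
  isHub-≢ {a} {b} = dec-false (a 𝔽.≟ b)

  adj-hub : ∀ h {y} → isHub y ≡ false → adjV (hub h) y ≡ attached y h
  adj-hub h ¬y rewrite isHub-hub h | ¬y = 𝔹.∨-identityʳ _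

  adj-nonhub : ∀ {x} h → isHub x ≡ false → adjV x (hub h) ≡ attached x h
  adj-nonhub h ¬x rewrite isHub-hub h | ¬x = refl

  adj-hubs : ∀ {x y} → isHub x ≡ true → isHub y ≡ true → adjV x y ≡ false
  adj-hubs hx hy rewrite hx | hy = refl

  adj-nonhubs : ∀ {x y} → isHub x ≡ false → isHub y ≡ false → adjV x y ≡ false
  adj-nonhubs ¬x ¬y rewrite ¬x | ¬y = refl

  -- The vertices cut off from the remaining hubs when the hubs in K are removed.
  inside : (Fin P → Bool) → V → Bool
  inside K (a , inj₁ b)        = K a ∧ K b
  inside K (a , inj₂ (inj₁ b)) = K a ∧ (K b ∧ good a b)
  inside K (a , inj₂ (inj₂ _)) = K a ∧ true

  -- What `K` would cut off if all its pairs were good. Its size depends on the size of `K` alone,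
  -- and `inside K` attains it just for good sets.
  block : (Fin P → Bool) → V → Bool
  block K (a , inj₁ b)        = K a ∧ K b
  block K (a , inj₂ (inj₁ b)) = K a ∧ K b
  block K (a , inj₂ (inj₂ _)) = K a ∧ true

  -- `k` hubs and k(k - 1) subdividers, k² second vertices, kW pendants.
  quota : ℕ → ℕ
  quota k = k * (k + (k + W))

  count-block : ∀ K → count (block K ∘ vertex) ≡ quota (count K)
  count-block K = trans (count-V (block K) K r (λ { a (inj₁ b) → refl ; a (inj₂ (inj₁ b)) → refl ; a (inj₂ (inj₂ w)) → refl }))
                        (cong (λ z → count K * (count K + (count K + z))) (count-true W))
    where
    r : Layer → Bool
    r (inj₁ b)        = K b
    r (inj₂ (inj₁ b)) = K b
    r (inj₂ (inj₂ _)) = true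

  AllGood : (Fin P → Bool) → Set
  AllGood K = ∀ a b → K a ≡ true → K b ≡ true → good a b ≡ true

  inside⊆block : ∀ K → inside K ⊆ᵇ block K
  inside⊆block K (a , inj₁ b) e        = e
  inside⊆block K (a , inj₂ (inj₁ b)) e with K a | K b
  ... | true | true = refl
  inside⊆block K (a , inj₂ (inj₂ w)) e = e

  block⊆inside : ∀ K → AllGood K → block K ⊆ᵇ inside K
  block⊆inside K all (a , inj₁ b) e        = e
  block⊆inside K all (a , inj₂ (inj₁ b)) e with K a in Ka | K b in Kb
  ... | true | true = all a b Ka Kb
  block⊆inside K all (a , inj₂ (inj₂ w)) e = e

-- Low-rank modifications that split the gadget yield cliques

module LowRankCut (P W : ℕ) (good : Fin P → Fin P → Bool) (k : ℕ)
                  (3k+2≤P : k + (suc k + suc k) ≤ P) (P²≤W : P * (P + P) ≤ W) where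
  open Gadget P W good

  -- Rows from `σ` and columns from outside: there the modified matrix is known.
  CutBy : (V → Bool) → Matrix N N → Set
  CutBy σ M = ∀ x y → σ x ≡ true → σ y ≡ false → M (index x) (index y) ≡ adjV x y

  module _ (σ : V → Bool) (M : Matrix N N) (cut : CutBy σ M)
           (rank≤k : ∀ r → IndependentRows M r → r ≤ k) where

    touched? : ∀ h → Dec (∃ λ w → σ (h , inj₂ (inj₂ w)) ≡ true)
    touched? h = 𝔽.any? λ w → σ (h , inj₂ (inj₂ w)) 𝔹.≟ true

    touched : Fin P → Bool
    touched h = σ (hub h) ∨ does (touched? h)

    -- A row and a column witnessing one unit of cut-rank for the touched hub h,
    -- where v is a hub on the other side.
    data Link (h v : Fin P) : V → V → Set where
      pendant  : ∀ w → σ (hub h) ≡ false → σ (h , inj₂ (inj₂ w)) ≡ true → Link h v (h , inj₂ (inj₂ w)) (hub h)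
      core-in  : σ (hub v) ≡ false → σ (h , inj₁ v) ≡ true → Link h v (h , inj₁ v) (hub v)
      core-out : σ (hub h) ≡ true → σ (h , inj₁ v) ≡ false → Link h v (hub h) (h , inj₁ v)

    -- If `h` is outside, it is separated from one of its pendants. If `h` is inside, the path from
    -- `h` through the subdivider of (h , v) to `v` leaves `σ` at one of its two edges.
    link : ∀ h v → touched h ≡ true → σ (hub v) ≡ false → ∃ λ x → ∃ λ y → Link h v x y
    link h v th σv with σ (hub h) in σh | touched? h
    ... | false | yes (w , σw) = _ , _ , pendant w σh σw
    link h v () σv | false | no _
    ... | true | _ with σ (h , inj₁ v) in σe
    ...   | true  = _ , _ , core-in σv σe
    ...   | false = _ , _ , core-out σh σe

    link-row : ∀ {h v x y} → Link h v x y → σ x ≡ true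
    link-row (pendant _ _ σx) = σx
    link-row (core-in _ σx)   = σx
    link-row (core-out σx _)  = σx

    link-column : ∀ {h v x y} → Link h v x y → σ y ≡ false
    link-column (pendant _ σy _) = σy
    link-column (core-in σy _)   = σy
    link-column (core-out _ σy)  = σy

    link-one : ∀ {h v x y} → Link h v x y → h ≢ v → adjV x y ≡ true
    link-one {h} {v} {x} (pendant w _ _) h≢v = trans (adj-nonhub {x} h refl) (dec-true (h 𝔽.≟ h) refl)
    link-one {h} {v} {x} (core-in _ _)   h≢v =
      trans (adj-nonhub {x} v (isHub-≢ h≢v)) (trans (cong (does (v 𝔽.≟ h) ∨_) (dec-true (v 𝔽.≟ v) refl)) (𝔹.∨-zeroʳ _))
    link-one {h} {v} {y = y} (core-out _ _) h≢v =
      trans (adj-hub h {y} (isHub-≢ h≢v)) (cong (_∨ does (h 𝔽.≟ v)) (dec-true (h 𝔽.≟ h) refl))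

    link-zero-hub : ∀ {h v x y} → Link h v x y → h ≢ v → ∀ g → g ≢ h → g ≢ v → adjV x (hub g) ≡ false
    link-zero-hub {h} {v} {x} (pendant w _ _) h≢v g g≢h g≢v =
      trans (adj-nonhub {x} g refl) (dec-false (g 𝔽.≟ h) g≢h)
    link-zero-hub {h} {v} {x} (core-in _ _)   h≢v g g≢h g≢v =
      trans (adj-nonhub {x} g (isHub-≢ h≢v)) (cong₂ _∨_ (dec-false (g 𝔽.≟ h) g≢h) (dec-false (g 𝔽.≟ v) g≢v))
    link-zero-hub {h} {v} {x} (core-out _ _)  h≢v g g≢h g≢v = adj-hubs {x} {hub g} (isHub-hub h) (isHub-hub g)

    link-zero-core : ∀ {h v x y} → Link h v x y → h ≢ v → ∀ a b → a ≢ b → h ≢ a → h ≢ b → adjV x (a , inj₁ b) ≡ false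
    link-zero-core {x = x} (pendant _ _ _) h≢v a b a≢b h≢a h≢b = adj-nonhubs {x} {a , inj₁ b} refl (isHub-≢ a≢b)
    link-zero-core {x = x} (core-in _ _)   h≢v a b a≢b h≢a h≢b = adj-nonhubs {x} {a , inj₁ b} (isHub-≢ h≢v) (isHub-≢ a≢b)
    link-zero-core {h}     (core-out _ _)  h≢v a b a≢b h≢a h≢b =
      trans (adj-hub h {a , inj₁ b} (isHub-≢ a≢b)) (cong₂ _∨_ (dec-false (h 𝔽.≟ a) h≢a) (dec-false (h 𝔽.≟ b) h≢b))

    -- Row and column of a link lie among `h`, `v`, the subdivider of (h , v) and the pendants of
    -- `h`, so links on disjoint pairs of hubs have no edges between them. `h ≢ v` matters because
    -- (h , inj₁ h) is itself a hub.
    link-zero : ∀ {h v x y h′ v′ x′ y′} → Link h v x y → h ≢ v → Link h′ v′ x′ y′ → h′ ≢ v′ →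
                h ≢ h′ → v ≢ v′ → h ≢ v′ → h′ ≢ v → adjV x y′ ≡ false
    link-zero ℓ h≢v (pendant _ _ _) h′≢v′ h≢h′ v≢v′ h≢v′ h′≢v = link-zero-hub ℓ h≢v _ (h≢h′ ∘ sym) h′≢v
    link-zero ℓ h≢v (core-in _ _)   h′≢v′ h≢h′ v≢v′ h≢v′ h′≢v = link-zero-hub ℓ h≢v _ (h≢v′ ∘ sym) (v≢v′ ∘ sym)
    link-zero ℓ h≢v (core-out _ _)  h′≢v′ h≢h′ v≢v′ h≢v′ h′≢v = link-zero-core ℓ h≢v _ _ h′≢v′ h≢h′ h≢v′

    -- Each touched hub gets its own partner outside, and the resulting links select an identity
    -- submatrix of size `m`.
    module Minor {m} (κ v : Fin m → Fin P)
                 (κ-injective : ∀ {i j} → κ i ≡ κ j → i ≡ j) (v-injective : ∀ {i j} → v i ≡ v j → i ≡ j)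
                 (v≢κ : ∀ i j → v i ≢ κ j)
                 (κ-touched : ∀ i → touched (κ i) ≡ true) (v-out : ∀ i → σ (hub (v i)) ≡ false) where

      row column : Fin m → V
      row    i = proj₁ (link (κ i) (v i) (κ-touched i) (v-out i))
      column i = proj₁ (proj₂ (link (κ i) (v i) (κ-touched i) (v-out i)))

      ℓ : ∀ i → Link (κ i) (v i) (row i) (column i)
      ℓ i = proj₂ (proj₂ (link (κ i) (v i) (κ-touched i) (v-out i)))

      κ≢v : ∀ i j → κ i ≢ v j
      κ≢v i j = v≢κ j i ∘ sym

      independent : LinearlyIndependent (λ i → M (index (row i)))
      independent = identity-independent _ (index ∘ column)
        (λ i → trans (cut _ _ (link-row (ℓ i)) (link-column (ℓ i))) (link-one (ℓ i) (κ≢v i i)))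
        (λ i j i≢j → trans (cut _ _ (link-row (ℓ i)) (link-column (ℓ j)))
          (link-zero (ℓ i) (κ≢v i i) (ℓ j) (κ≢v j j) (i≢j ∘ κ-injective) (i≢j ∘ v-injective) (κ≢v i j) (κ≢v j i)))

      m≤k : m ≤ k
      m≤k = rank≤k m (index ∘ row , independent)

      -- The column of `g` is zero on every link row because `g` belongs to none of the pairs, while
      -- it is one on row `x`; hence the matrix stays triangular.
      extended : ∀ x g → σ x ≡ true → σ (hub g) ≡ false → isHub x ≡ false → attached x g ≡ true →
                 (∀ i → g ≢ κ i) → (∀ i → g ≢ v i) → suc m ≤ k
      extended x g σx σg nonhub xg g≢κ g≢v = rank≤k (suc m) (index ∘ cons x row ,
        extend-independent (λ i → M (index (cons x row i))) (index (hub g))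
          (trans (cut x (hub g) σx σg) (trans (adj-nonhub {x} g nonhub) xg))
          (λ i → trans (cut _ _ (link-row (ℓ i)) σg) (link-zero-hub (ℓ i) (κ≢v i i) g (g≢κ i) (g≢v i)))
          independent)

    -- Pairing `suc k` hubs of one side with `suc k` of the other yields `suc k` links, more than
    -- the rank permits.
    count-mixed-hubs : suc k ≤ count (σ ∘ hub) → suc k ≤ count (not ∘ σ ∘ hub) → ⊥
    count-mixed-hubs k<in k<out =
      let κ , κ-inj , κ∈ = choose (σ ∘ hub) k<in
          v , v-inj , v∈ = choose (not ∘ σ ∘ hub) k<out
      in ℕ.<-irrefl refl (Minor.m≤k κ v κ-inj v-inj
        (λ i j eq → contradiction (trans (sym (v∈ i)) (cong not (trans (cong (σ ∘ hub) eq) (κ∈ j)))) λ ())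
        (λ i → cong (_∨ does (touched? (κ i))) (κ∈ i))
        (λ i → 𝔹.not-injective (v∈ i)))

    module _ (few : count (σ ∘ hub) ≤ k) (large : quota k ≤ count (σ ∘ vertex)) where

      outside : Fin P → Bool
      outside = not ∘ σ ∘ hub

      many-outside : suc k + suc k ≤ count outside
      many-outside = ℕ.+-cancelˡ-≤ k _ _ (begin
        k + (suc k + suc k)                ≤⟨ 3k+2≤P ⟩
        P                                  ≡⟨ count-not (σ ∘ hub) ⟨
        count (σ ∘ hub) + count outside    ≤⟨ ℕ.+-monoˡ-≤ _ few ⟩
        k + count outside                  ∎)
        where open ℕ.≤-Reasoning

      touched≤k : count touched ≤ k
      touched≤k = ℕ.≮⇒≥ λ k<touched →
        let κ , κ-inj , κ∈ = choose touched k<touched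
            -- A hub touched only through a pendant lies outside too, so the `suc k` partners have
            -- to avoid the `suc k` touched hubs.
            v , v-inj , v∈ , v≢κ = chooseAvoiding (suc k) κ outside many-outside
        in ℕ.<-irrefl refl (Minor.m≤k κ v κ-inj v-inj v≢κ κ∈ (λ i → 𝔹.not-injective (v∈ i)))

      -- The constant factors give the product form that `count-V` asks for, so that its hypothesis
      -- holds by `refl`.
      pendantOf core : V → Bool
      pendantOf (a , inj₂ (inj₂ _)) = touched a ∧ true
      pendantOf (a , _)             = touched a ∧ false
      core (a , inj₂ (inj₂ _)) = false
      core (a , _)             = true

      count-pendantOf : count (pendantOf ∘ vertex) ≡ count touched * W
      count-pendantOf = trans
        (count-V pendantOf touched (λ { (inj₂ (inj₂ _)) → true ; _ → false })
          λ { a (inj₁ _) → refl ; a (inj₂ (inj₁ _)) → refl ; a (inj₂ (inj₂ _)) → refl })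
        (cong (count touched *_) (cong₂ _+_ (count-false P) (cong₂ _+_ (count-false P) (count-true W))))

      count-core : count (core ∘ vertex) ≡ P * (P + P)
      count-core = trans
        (count-V core (λ _ → true) (λ { (inj₂ (inj₂ _)) → false ; _ → true })
          λ { a (inj₁ _) → refl ; a (inj₂ (inj₁ _)) → refl ; a (inj₂ (inj₂ _)) → refl })
        (cong₂ _*_ (count-true P) (cong₂ _+_ (count-true P)
          (trans (cong₂ _+_ (count-true P) (count-false W)) (ℕ.+-identityʳ P))))

      σ⊆pendantOf∨core : ∀ x → σ x ≡ true → (pendantOf x ∨ core x) ≡ true
      σ⊆pendantOf∨core (a , inj₁ b)        _  = 𝔹.∨-zeroʳ _
      σ⊆pendantOf∨core (a , inj₂ (inj₁ b)) _  = 𝔹.∨-zeroʳ _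
      σ⊆pendantOf∨core (a , inj₂ (inj₂ w)) σx = trans (𝔹.∨-identityʳ _) (trans (𝔹.∧-identityʳ _)
        (trans (cong (σ (hub a) ∨_) (dec-true (touched? a) (w , σx))) (𝔹.∨-zeroʳ _)))

      quota≤ : quota k ≤ count touched * W + W
      quota≤ = begin
        quota k                                                ≤⟨ large ⟩
        count (σ ∘ vertex)                                     ≤⟨ count-mono (σ⊆pendantOf∨core ∘ vertex) ⟩
        count (λ x → pendantOf (vertex x) ∨ core (vertex x))   ≤⟨ count-∨ (pendantOf ∘ vertex) (core ∘ vertex) ⟩
        count (pendantOf ∘ vertex) + count (core ∘ vertex)     ≡⟨ cong₂ _+_ count-pendantOf count-core ⟩
        count touched * W + P * (P + P)                        ≤⟨ ℕ.+-monoʳ-≤ _ P²≤W ⟩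
        count touched * W + W                                  ∎
        where open ℕ.≤-Reasoning

      -- With c < k touched hubs the side has at most cW pendants and at most W other vertices,
      -- together at most kW, whereas `quota k` is kW + 2k². The number of pendants is chosen for
      -- this.
      k≤touched : k ≤ count touched
      k≤touched = ℕ.≮⇒≥ λ touched<k → ℕ.<⇒≱ (exceeds touched<k) quota≤
        where
        open ℕ.≤-Reasoning
        rearrange : ∀ k W → k * W + k * (k + k) ≡ k * (k + (k + W))
        rearrange = solve-∀
        positive : ∀ {c} → c < k → 0 < k * (k + k)
        positive {c} (s≤s _) = s≤s z≤n
        exceeds : ∀ {c} → c < k → c * W + W < quota k
        exceeds {c} c<k = begin-strict
          c * W + W              ≡⟨ ℕ.+-comm _ W ⟩
          suc c * W              ≤⟨ ℕ.*-monoˡ-≤ W c<k ⟩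
          k * W                  <⟨ ℕ.m<m+n (k * W) (positive c<k) ⟩
          k * W + k * (k + k)    ≡⟨ rearrange k W ⟩
          quota k                ∎

      touched≡k : count touched ≡ k
      touched≡k = ℕ.≤-antisym touched≤k k≤touched

      hub∈touched : ∀ h → touched h ≡ false → σ (hub h) ≡ false
      hub∈touched h th with false ← σ (hub h) = refl

      untouched : ∃ λ g → touched g ≡ false
      untouched = let g , _ , g∈ = choose {m = 1} (not ∘ touched) (ℕ.+-cancelˡ-≤ k _ _ (begin
                        k + 1                                  ≤⟨ ℕ.+-monoʳ-≤ k (s≤s z≤n) ⟩
                        k + (suc k + suc k)                    ≤⟨ 3k+2≤P ⟩
                        P                                      ≡⟨ count-not touched ⟨
                        count touched + count (not ∘ touched)  ≤⟨ ℕ.+-monoˡ-≤ _ touched≤k ⟩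
                        k + count (not ∘ touched)              ∎))
                  in g zero , 𝔹.not-injective (g∈ zero)
        where open ℕ.≤-Reasoning

      exit : ∀ x → inside touched x ≡ false → ∃ λ g → attached x g ≡ true × touched g ≡ false
      exit (a , inj₁ b) out with touched a in ta
      ... | false = a , cong (_∨ does (a 𝔽.≟ b)) (dec-true (a 𝔽.≟ a) refl) , ta
      ... | true  = b , trans (cong (does (b 𝔽.≟ a) ∨_) (dec-true (b 𝔽.≟ b) refl)) (𝔹.∨-zeroʳ _) , out
      exit (a , inj₂ (inj₁ b)) out with touched a in ta
      ... | false = a , cong (λ z → (z ∨ does (a 𝔽.≟ b)) ∨ not (good a b)) (dec-true (a 𝔽.≟ a) refl) , ta
      ... | true with touched b in tb
      ...   | false = b , cong (_∨ not (good a b)) (trans (cong (does (b 𝔽.≟ a) ∨_) (dec-true (b 𝔽.≟ b) refl)) (𝔹.∨-zeroʳ _)) , tb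
      -- Here `a` and `b` are touched but not good, so the vertex is adjacent to all hubs and any
      -- untouched one will do.
      ...   | true  = let g , tg = untouched in
                      g , trans (cong (λ z → (does (g 𝔽.≟ a) ∨ does (g 𝔽.≟ b)) ∨ not z) out) (𝔹.∨-zeroʳ _) , tg
      exit (a , inj₂ (inj₂ w)) out = a , dec-true (a 𝔽.≟ a) refl , trans (sym (𝔹.∧-identityʳ _)) out

      -- `k` touched hubs already give `k` links, and the edge from `x` to `g` adds one to the rank.
      -- The partners must avoid `g` as well, whence `cons g κ`.
      no-exit : ∀ x → σ x ≡ true → isHub x ≡ false → ∀ g → attached x g ≡ true → touched g ≡ false → ⊥
      no-exit x σx nonhub g xg tg =
        let κ , κ-inj , κ∈ = choose touched k≤touched
            v , v-inj , v∈ , v≢κ = chooseAvoiding (suc k) (cons g κ) outside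
              (ℕ.≤-trans (ℕ.+-monoʳ-≤ (suc k) (ℕ.n≤1+n k)) many-outside)
        in ℕ.<-irrefl refl (Minor.extended κ v κ-inj v-inj (λ i j → v≢κ i (suc j)) κ∈
          (λ i → 𝔹.not-injective (v∈ i)) x g σx (hub∈touched g tg) nonhub xg
          (λ i eq → contradiction (trans (sym tg) (trans (cong touched eq) (κ∈ i))) λ ())
          (λ i → v≢κ i zero ∘ sym))

      σ⊆inside : σ ⊆ᵇ inside touched
      σ⊆inside x σx with inside touched x in out | isHub x in hx
      ... | true  | _     = refl
      ... | false | false = let g , xg , tg = exit x out in ⊥-elim (no-exit x σx hx g xg tg)
      ... | false | true  = ⊥-elim (case trans (sym out) (subst (λ y → inside touched y ≡ true) (sym x≡hub) (cong₂ _∧_ t t)) of λ ())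
        where
        x≡hub = isHub⇒hub x hx
        t : touched (proj₁ x) ≡ true
        t = cong (_∨ does (touched? (proj₁ x))) (trans (cong σ (sym x≡hub)) σx)

      -- The side lies in `inside touched`, hence in a block of size `quota k`, and has at least
      -- that size. A bad pair would leave its second vertex in the block but not inside, making the
      -- bound strict.
      allGood : AllGood touched
      allGood a b ta tb with good a b in gab
      ... | true  = refl
      ... | false = contradiction large (ℕ.<⇒≱ (begin-strict
        count (σ ∘ vertex)                  ≤⟨ count-mono (σ⊆inside ∘ vertex) ⟩
        count (inside touched ∘ vertex)     <⟨ count-strict (inside⊆block touched ∘ vertex) (index bad) in-block not-inside ⟩
        count (block touched ∘ vertex)      ≡⟨ count-block touched ⟩
        quota (count touched)               ≡⟨ cong quota touched≡k ⟩
        quota k                             ∎))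
        where
        open ℕ.≤-Reasoning
        bad = a , inj₂ (inj₁ b)
        in-block : block touched (vertex (index bad)) ≡ true
        in-block = trans (cong (block touched) (vertex-index bad)) (cong₂ _∧_ ta tb)
        not-inside : inside touched (vertex (index bad)) ≡ false
        not-inside = trans (cong (inside touched) (vertex-index bad)) (trans (cong₂ _∧_ ta (cong₂ _∧_ tb gab)) refl)

      goodSet : ∃ λ K → count K ≡ k × AllGood K
      goodSet = touched , touched≡k , allGood

  -- The hypothesis on `M` is symmetric in the two sides, so the argument runs on whichever has at
  -- most `k` hubs; `count-mixed-hubs` shows that one of them does.
  cut⇒goodSet : (s : Fin N → Bool) → quota k ≤ count s → quota k ≤ count (not ∘ s) →
                (M : Matrix N N) → (∀ x y → s x ≢ s y → M x y ≡ adj H x y) →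
                (∀ r → IndependentRows M r → r ≤ k) → ∃ λ K → count K ≡ k × AllGood K
  cut⇒goodSet s large colarge M cut rank≤k with count (σ ∘ hub) ℕ.≤? k | count (not ∘ σ ∘ hub) ℕ.≤? k
    where σ = s ∘ index
  ... | yes few | _ = goodSet (s ∘ index) M cut₁ rank≤k few (subst (quota k ≤_) (count-cong λ x → cong s (sym (index-vertex x))) large)
    where
    cut₁ : CutBy (s ∘ index) M
    cut₁ x y σx σy = trans (cut (index x) (index y) λ eq → contradiction (trans (sym σx) (trans eq σy)) λ ())
                          (cong₂ adjV (vertex-index x) (vertex-index y))
  ... | no _ | yes few = goodSet (not ∘ s ∘ index) M cut₂ rank≤k few
      (subst (quota k ≤_) (count-cong λ x → cong (not ∘ s) (sym (index-vertex x))) colarge)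
    where
    cut₂ : CutBy (not ∘ s ∘ index) M
    cut₂ x y σx σy = trans (cut (index x) (index y) λ eq → contradiction (trans (sym σx) (trans (cong not eq) σy)) λ ())
                          (cong₂ adjV (vertex-index x) (vertex-index y))
  ... | no many | no comany = ⊥-elim (count-mixed-hubs (s ∘ index) M cut₃ rank≤k (ℕ.≰⇒> many) (ℕ.≰⇒> comany))
    where
    cut₃ : CutBy (s ∘ index) M
    cut₃ x y σx σy = trans (cut (index x) (index y) λ eq → contradiction (trans (sym σx) (trans eq σy)) λ ())
                          (cong₂ adjV (vertex-index x) (vertex-index y))

-- Cliques yield low-rank modifications that split the gadget

module CliqueCut (P W : ℕ) (good : Fin P → Fin P → Bool)
                 (K : Fin P → Bool) (allGood : Gadget.AllGood P W good K) where
  open Gadget P W good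

  k : ℕ
  k = count K

  κ : Fin k → Fin P
  κ = proj₁ (enumerate K)

  κ-injective : ∀ {i j} → κ i ≡ κ j → i ≡ j
  κ-injective = proj₁ (proj₂ (enumerate K))

  κ-surjective : ∀ h → K h ≡ true → ∃ λ i → κ i ≡ h
  κ-surjective = proj₂ (proj₂ (proj₂ (enumerate K)))

  -- h itself together with its neighbours outside: flipping within this set
  -- isolates h from the outside at the cost of rank one.
  star : Fin P → V → Bool
  star h x = if inside K x then isHub x ∧ does (h 𝔽.≟ proj₁ x) else not (isHub x) ∧ attached x h

  -- The product of a matrix with `k` columns and its transpose. Between inside and outside it has
  -- to reproduce the edges of `H`; elsewhere its values are free.
  flip : V → V → Bool
  flip x y = sumGF2 (λ i → star (κ i) x ∧ star (κ i) y)

  flip-sym : ∀ x y → flip x y ≡ flip y x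
  flip-sym x y = sum-cong-≗ λ i → 𝔹.∧-comm (star (κ i) x) (star (κ i) y)

  attached⇒K : ∀ x → inside K x ≡ true → ∀ h → attached x h ≡ true → K h ≡ true
  attached⇒K (a , inj₁ b) in-x h xh with ∨-true xh
  ... | inj₁ e with refl ← does-true {d = h 𝔽.≟ a} e = proj₁ (∧-true in-x)
  ... | inj₂ e with refl ← does-true {d = h 𝔽.≟ b} e = proj₂ (∧-true in-x)
  attached⇒K (a , inj₂ (inj₁ b)) in-x h xh with ∨-true xh
  ... | inj₂ e = contradiction (trans (sym e) (cong not (proj₂ (∧-true {K b} (proj₂ (∧-true {K a} in-x)))))) λ ()
  ... | inj₁ xh′ with ∨-true xh′
  ...   | inj₁ e with refl ← does-true {d = h 𝔽.≟ a} e = proj₁ (∧-true in-x)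
  ...   | inj₂ e with refl ← does-true {d = h 𝔽.≟ b} e = proj₁ (∧-true (proj₂ (∧-true {K a} in-x)))
  attached⇒K (a , inj₂ (inj₂ w)) in-x h xh with refl ← does-true {d = h 𝔽.≟ a} xh = proj₁ (∧-true in-x)

  -- Among the vertices inside, `star (κ i)` contains only the hub `κ i`, so a single summand
  -- survives. For the same reason all summands vanish at a non-hub inside.
  flip-hub : ∀ h y → K h ≡ true → inside K y ≡ false → flip (hub h) y ≡ not (isHub y) ∧ attached y h
  flip-hub h y Kh out rewrite out | Kh | isHub-hub h = let i₀ , κi₀≡h = κ-surjective h Kh in
    trans (sum-single _ i₀ λ i i≢i₀ → cong (_∧ (not (isHub y) ∧ attached y (κ i)))
             (dec-false (κ i 𝔽.≟ h) λ κi≡h → i≢i₀ (κ-injective (trans κi≡h (sym κi₀≡h)))))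
          (trans (cong (_∧ (not (isHub y) ∧ attached y (κ i₀))) (dec-true (κ i₀ 𝔽.≟ h) κi₀≡h)) (cong (λ g → not (isHub y) ∧ attached y g) κi₀≡h))

  flip-nonhub : ∀ x y → inside K x ≡ true → isHub x ≡ false → flip x y ≡ false
  flip-nonhub x y in-x nonhub rewrite in-x | nonhub = sum-zero {k} _ λ _ → refl

  adj≡flip-hub : ∀ h y → inside K (hub h) ≡ true → inside K y ≡ false → adjV (hub h) y ≡ flip (hub h) y
  adj≡flip-hub h y in-h out-y = trans (by-kind (isHub y) refl) (sym (flip-hub h y (proj₁ (∧-true in-h)) out-y))
    where
    by-kind : ∀ b → isHub y ≡ b → adjV (hub h) y ≡ not (isHub y) ∧ attached y h
    by-kind true  hy = trans (adj-hubs {hub h} {y} (isHub-hub h) hy) (cong (λ b → not b ∧ attached y h) (sym hy))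
    by-kind false hy = trans (adj-hub h {y} hy) (cong (λ b → not b ∧ attached y h) (sym hy))

  adj≡flip-nonhub : ∀ x y → isHub x ≡ false → inside K x ≡ true → inside K y ≡ false → adjV x y ≡ flip x y
  adj≡flip-nonhub x y hx in-x out-y = trans (by-kind (isHub y) refl) (sym (flip-nonhub x y in-x hx))
    where
    by-kind : ∀ b → isHub y ≡ b → adjV x y ≡ false
    by-kind false hy = adj-nonhubs {x} {y} hx hy
    by-kind true  hy = trans (cong (adjV x) (isHub⇒hub y hy)) (trans (adj-nonhub {x} (proj₁ y) hx) (𝔹.¬-not detached))
      where
      detached : attached x (proj₁ y) ≢ true
      detached xh = contradiction (trans (sym out-y) (trans (cong (inside K) (isHub⇒hub y hy)) (cong₂ _∧_ Ky Ky))) λ ()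
        where Ky = attached⇒K x in-x (proj₁ y) xh

  adj≡flip : ∀ x y → inside K x ≡ true → inside K y ≡ false → adjV x y ≡ flip x y
  adj≡flip x y in-x out-y = by-kind (isHub x) refl
    where
    by-kind : ∀ b → isHub x ≡ b → adjV x y ≡ flip x y
    by-kind false hx = adj≡flip-nonhub x y hx in-x out-y
    by-kind true  hx = subst (λ z → adjV z y ≡ flip z y) (sym x≡hub)
      (adj≡flip-hub (proj₁ x) y (trans (cong (inside K) (sym x≡hub)) in-x) out-y)
      where x≡hub = isHub⇒hub x hx

  M : Matrix N N
  M x y = flip (vertex x) (vertex y)

  G′ : Graph N
  G′ .adj x y = if does (x 𝔽.≟ y) then false else adj H x y xor M x y
  G′ .symmetric x y with x 𝔽.≟ y | y 𝔽.≟ x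
  ... | yes _   | yes _   = refl
  ... | yes x≡y | no y≢x  = contradiction (sym x≡y) y≢x
  ... | no x≢y  | yes y≡x = contradiction (sym y≡x) x≢y
  ... | no _    | no _    = cong₂ _xor_ (symmetric H x y) (flip-sym (vertex x) (vertex y))
  G′ .loopless x = cong (λ b → if b then false else adj H x x xor M x x) (dec-true (x 𝔽.≟ x) refl)

  -- Off the diagonal `H ⊕ G′` is `M`; the filling restores the diagonal of `M`, which a loopless
  -- graph cannot carry.
  filled : ∀ x y → fillDiagonal (H ⊕ G′) (λ z → M z z) x y ≡ M x y
  filled x y with x 𝔽.≟ y
  ... | yes refl = refl
  ... | no _     = trans (sym (𝔹.xor-assoc (adj H x y) (adj H x y) (M x y)))
                         (cong (_xor M x y) (𝔹.xor-same (adj H x y)))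

  rank≤k : ∀ r → IndependentRows (fillDiagonal (H ⊕ G′) (λ z → M z z)) r → r ≤ k
  rank≤k r (ρ , indep) = factored-rank (λ x i → star (κ i) (vertex x)) (λ i y → star (κ i) (vertex y)) r
    (ρ , LinearlyIndependent-resp (λ i → filled (ρ i)) indep)

  region : Fin N → Bool
  region = inside K ∘ vertex

  region-crossing : ∀ x y → region x ≡ true → region y ≡ false → adj G′ x y ≡ false
  region-crossing x y in-x out-y with x 𝔽.≟ y
  ... | yes _ = refl
  ... | no _  = trans (cong (_xor M x y) (adj≡flip (vertex x) (vertex y) in-x out-y)) (𝔹.xor-same (M x y))

  region-edge : ∀ x y → Edge G′ x y → region x ≡ region y
  region-edge x y e = agree _ _ refl refl
    where
    agree : ∀ a b → region x ≡ a → region y ≡ b → a ≡ b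
    agree true  true  rx ry = refl
    agree false false rx ry = refl
    agree true  false rx ry = contradiction (trans (sym e) (region-crossing x y rx ry)) λ ()
    agree false true  rx ry = contradiction (trans (sym (edge-sym G′ {x} {y} e)) (region-crossing y x ry rx)) λ ()

  region-path : ∀ {x y} → Star (Edge G′) x y → region x ≡ region y
  region-path ε        = refl
  region-path (e ◅ es) = trans (region-edge _ _ e) (region-path es)

  count-region : count region ≡ quota k
  count-region = trans (ℕ.≤-antisym (count-mono (inside⊆block K ∘ vertex)) (count-mono (block⊆inside K allGood ∘ vertex)))
                       (count-block K)

  module _ (2q≤N : quota k + quota k ≤ N) where
    -- A component stays within the region, of size `quota k`, or within its complement; `2q≤N`
    -- makes the complement the larger of the two.
    small : ∀ C → IsComponent G′ C → ∣ C ∣ ≤ N ∸ quota k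
    small C ((u , u∈) , comp) = subst (_≤ N ∸ quota k) (sym (∣∣≡count C)) (side (region u) refl)
      where
      same : ∀ w → Vec.lookup C w ≡ true → region w ≡ region u
      same w w∈ = sym (region-path (Equivalence.to (comp u w u∈) (lookup⇒∈ w∈)))
      side : ∀ b → region u ≡ b → count (Vec.lookup C) ≤ N ∸ quota k
      side true  ru = ℕ.≤-trans (count-mono λ w w∈ → trans (same w w∈) ru)
        (subst (_≤ N ∸ quota k) (sym count-region)
          (subst (_≤ N ∸ quota k) (ℕ.m+n∸n≡m (quota k) (quota k)) (ℕ.∸-monoˡ-≤ (quota k) 2q≤N)))
      side false ru = ℕ.≤-trans (count-mono {q = not ∘ region} λ w w∈ → cong not (trans (same w w∈) ru))
        (ℕ.≤-reflexive (trans (sym (ℕ.m+n∸m≡n (count region) (count (not ∘ region))))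
          (cong₂ _∸_ (count-not region) count-region)))

    clique⇒rankIntegrity≤ : RankIntegrity≤ H k (N ∸ quota k)
    clique⇒rankIntegrity≤ = G′ , ((λ z → M z z) , rank≤k) , small

-- The reduction

module Reduction {n} (G : Graph n) (k : ℕ) where
  -- `k` allows for the hubs on the side with few hubs. Of the `suc k + suc k` remaining on the
  -- other side, half become partners in links and half make up for hubs that partners must avoid.
  -- `W` is the number of vertices that are not pendants.
  padding P W : ℕ
  padding = k + (suc k + suc k)
  P = n + padding
  W = P * (P + P)

  -- The padding hubs are not even compatible with themselves, which keeps them
  -- out of cliques of size one.
  compatible : Fin n ⊎ Fin padding → Fin n ⊎ Fin padding → Bool
  compatible (inj₁ a) (inj₁ b) = does (a 𝔽.≟ b) ∨ adj G a b
  compatible (inj₁ _) (inj₂ _) = false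
  compatible (inj₂ _) _        = false

  good : Fin P → Fin P → Bool
  good a b = compatible (splitAt n a) (splitAt n b)

  open Gadget P W good
  open LowRankCut P W good k (ℕ.m≤n+m padding n) ℕ.≤-refl using (cut⇒goodSet)

  target : Instance RANK-INTEGRITY
  target = N , H , k , N ∸ quota k

  HasClique : Set
  HasClique = ∃[ C ] (IsClique G C × ∣ C ∣ ≡ k)

  3k≤P : k + (k + k) ≤ P
  3k≤P = ℕ.≤-trans (ℕ.+-monoʳ-≤ k (ℕ.+-mono-≤ (ℕ.n≤1+n k) (ℕ.n≤1+n k))) (ℕ.m≤n+m padding n)

  3q≤N : quota k + (quota k + quota k) ≤ N
  3q≤N = begin
    quota k + (quota k + quota k)       ≡⟨ rearrange k (k + (k + W)) ⟩
    (k + (k + k)) * (k + (k + W))       ≤⟨ ℕ.*-mono-≤ 3k≤P (ℕ.+-mono-≤ k≤P (ℕ.+-monoˡ-≤ W k≤P)) ⟩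
    N                                   ∎
    where
    open ℕ.≤-Reasoning
    rearrange : ∀ a b → a * b + (a * b + a * b) ≡ (a + (a + a)) * b
    rearrange = solve-∀
    k≤P : k ≤ P
    k≤P = ℕ.≤-trans (ℕ.m≤m+n k (k + k)) 3k≤P

  2q≤N : quota k + quota k ≤ N
  2q≤N = ℕ.≤-trans (ℕ.m≤n+m _ (quota k)) 3q≤N

  clique⇒goodSet : HasClique → ∃ λ K → count K ≡ k × AllGood K
  clique⇒goodSet (C , clique , card) = K , count-K , allGood
    where
    member : Fin n ⊎ Fin padding → Bool
    member (inj₁ a) = Vec.lookup C a
    member (inj₂ _) = false
    K : Fin P → Bool
    K a = member (splitAt n a)
    count-K : count K ≡ k
    count-K = begin
      count K                                                          ≡⟨ count-+ n K ⟩
      count (λ (a : Fin n) → K (a ↑ˡ padding)) + count (λ j → K (n ↑ʳ j))         ≡⟨ cong₂ _+_ (count-cong λ a → cong member (𝔽.splitAt-↑ˡ n a padding))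
                                                                                     (count-cong λ j → cong member (𝔽.splitAt-↑ʳ n padding j)) ⟩
      count (Vec.lookup C) + count {padding} (λ _ → false)             ≡⟨ cong₂ _+_ (trans (sym (∣∣≡count C)) card) (count-false padding) ⟩
      k + 0                                                            ≡⟨ ℕ.+-identityʳ k ⟩
      k                                                                ∎
      where open ≡-Reasoning
    members-compatible : ∀ a b → member a ≡ true → member b ≡ true → compatible a b ≡ true
    members-compatible (inj₁ a) (inj₁ b) Ca Cb with a 𝔽.≟ b
    ... | yes _  = refl
    ... | no a≢b = clique a b (lookup⇒∈ Ca) (lookup⇒∈ Cb) a≢b
    members-compatible (inj₂ _) (inj₁ _) ()
    members-compatible (inj₂ _) (inj₂ _) ()
    members-compatible (inj₁ _) (inj₂ _) _ ()
    allGood : AllGood K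
    allGood a b = members-compatible (splitAt n a) (splitAt n b)

  goodSet⇒clique : (∃ λ K → count K ≡ k × AllGood K) → HasClique
  goodSet⇒clique (K , count-K , allGood) = C , clique , card
    where
    C : Subset n
    C = Vec.tabulate λ a → K (a ↑ˡ padding)
    -- `AllGood` at equal arguments keeps padding hubs out of `K`.
    real : ∀ j → K (n ↑ʳ j) ≡ false
    real j = 𝔹.¬-not λ Kj → contradiction
      (trans (sym (cong₂ compatible (𝔽.splitAt-↑ʳ n padding j) (𝔽.splitAt-↑ʳ n padding j))) (allGood _ _ Kj Kj)) λ ()
    card : ∣ C ∣ ≡ k
    card = begin
      ∣ C ∣                                                      ≡⟨ ∣∣≡count C ⟩
      count (Vec.lookup C)                                       ≡⟨ count-cong (𝕍.lookup∘tabulate λ (a : Fin n) → K (a ↑ˡ padding)) ⟩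
      count (λ (a : Fin n) → K (a ↑ˡ padding))                             ≡⟨ ℕ.+-identityʳ _ ⟨
      count (λ (a : Fin n) → K (a ↑ˡ padding)) + 0                         ≡⟨ cong (count (λ (a : Fin n) → K (a ↑ˡ padding)) +_) (trans (count-cong real) (count-false padding)) ⟨
      count (λ (a : Fin n) → K (a ↑ˡ padding)) + count (λ j → K (n ↑ʳ j))  ≡⟨ count-+ n K ⟨
      count K                                                    ≡⟨ count-K ⟩
      k                                                          ∎
      where open ≡-Reasoning
    K-member : ∀ {a} → a ∈ C → K (a ↑ˡ padding) ≡ true
    K-member {a} a∈ = trans (sym (𝕍.lookup∘tabulate _ a)) (∈⇒lookup a∈)
    clique : IsClique G C
    clique a b a∈ b∈ a≢b = trans (sym (cong (_∨ adj G a b) (dec-false (a 𝔽.≟ b) a≢b)))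
      (trans (sym (cong₂ compatible (𝔽.splitAt-↑ˡ n a padding) (𝔽.splitAt-↑ˡ n b padding)))
             (allGood _ _ (K-member a∈) (K-member b∈)))

  goodSet⇒rankIntegrity≤ : (∃ λ K → count K ≡ k × AllGood K) → RankIntegrity≤ H k (N ∸ quota k)
  goodSet⇒rankIntegrity≤ (K , count-K , allGood) = subst (λ j → RankIntegrity≤ H j (N ∸ quota j)) count-K
    (CliqueCut.clique⇒rankIntegrity≤ P W good K allGood
      (subst (λ j → quota j + quota j ≤ N) (sym count-K) 2q≤N))

  rankIntegrity≤⇒goodSet : RankIntegrity≤ H k (N ∸ quota k) → ∃ λ K → count K ≡ k × AllGood K
  rankIntegrity≤⇒goodSet (G′ , (d , rank≤k) , small) =
    let s , closed , large , colarge = BalancedCut.balancedCut G′ (quota k) 3q≤N small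
    in cut⇒goodSet s large colarge (fillDiagonal (H ⊕ G′) d) (unchanged s closed) rank≤k
    where
    -- A pair separated by `s` is neither an edge of `G′` nor on the diagonal, so the entry is that
    -- of `H` for every filling `d`.
    unchanged : ∀ s → (∀ u v → Edge G′ u v → s u ≡ s v) → ∀ x y → s x ≢ s y → fillDiagonal (H ⊕ G′) d x y ≡ adj H x y
    unchanged s closed x y sx≢sy with x 𝔽.≟ y
    ... | yes refl = contradiction refl sx≢sy
    ... | no _     = trans (cong (adj H x y xor_) (𝔹.¬-not (sx≢sy ∘ closed x y))) (𝔹.xor-identityʳ _)

  reduction-correct : HasClique ⇔ (∃[ s ] (RankIntegrity H k s × s ≤ N ∸ quota k))
  reduction-correct = mk⇔
    (rankIntegrity≤-intro H k ∘ goodSet⇒rankIntegrity≤ ∘ clique⇒goodSet)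
    (goodSet⇒clique ∘ rankIntegrity≤⇒goodSet ∘ rankIntegrity≤-elim H k)

-- Program verification

Triple : (State → Set) → Program → ℕ → (State → Set) → Set
Triple A p T B = ∀ σ → A σ → ∃ λ t → ∃ λ τ → Exec p σ t τ × t ≤ T × B τ

assign : ℕ → ℕ → State → State
assign x v σ = state (regs σ [ x ↦ v ]) (arrs σ)

-- A frame condition. For concrete registers the comparisons inside the update compute, so if `F`
-- does not read `x`, the identity proves it.
Stable : ℕ → (State → Set) → Set
Stable x F = ∀ v σ → F σ → F (assign x v σ)

infixr 4 _⨾ᵗ_

_⨾ᵗ_ : ∀ {A B C p q T U} → Triple A p T B → Triple B q U C → Triple A (p ⨾ q) (T + U) C
(f ⨾ᵗ g) σ a =
  let s , τ , p⇓ , s≤T , b = f σ a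
      t , υ , q⇓ , t≤U , c = g τ b
  in s + t , υ , (p⇓ ⨾ q⇓) , ℕ.+-mono-≤ s≤T t≤U , c

weaken : ∀ {A B C p T} → (∀ σ → B σ → C σ) → Triple A p T B → Triple A p T C
weaken B⇒C f σ a = let t , τ , p⇓ , t≤T , b = f σ a in t , τ , p⇓ , t≤T , B⇒C τ b

strengthen : ∀ {A B C p T} → (∀ σ → A σ → B σ) → Triple B p T C → Triple A p T C
strengthen A⇒B f σ a = f σ (A⇒B σ a)

≡ᵇ-refl : ∀ x → (x ≡ᵇ x) ≡ true
≡ᵇ-refl zero    = refl
≡ᵇ-refl (suc x) = ≡ᵇ-refl x

≡ᵇ-≢ : ∀ {x y} → x ≢ y → (x ≡ᵇ y) ≡ false
≡ᵇ-≢ {x} {y} x≢y = 𝔹.¬-not λ x≡ᵇy → x≢y (ℕ.≡ᵇ⇒≡ x y (subst T (sym x≡ᵇy) _))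

update-same : ∀ {A : Set} (f : ℕ → A) i x → (f [ i ↦ x ]) i ≡ x
update-same f i x = cong (if_then x else f i) (≡ᵇ-refl i)

update-other : ∀ {A : Set} (f : ℕ → A) {i j} x → j ≢ i → (f [ i ↦ x ]) j ≡ f j
update-other f {i} {j} x j≢i = cong (if_then x else f j) (≡ᵇ-≢ j≢i)

set : ∀ {F : State → Set} x e (v : ℕ) → Stable x F → (∀ {σ} → F σ → ⟦ e ⟧ σ ≡ v) →
      Triple F (setReg x e) 1 (λ σ → F σ × regs σ x ≡ v)
set x e v stable value σ f =
  1 , _ , setReg , ℕ.≤-refl , stable (⟦ e ⟧ σ) σ f , trans (update-same (regs σ) x (⟦ e ⟧ σ)) (value f)

for : ℕ → Expr → Program → Program
for x e p = setReg x (lit 0) ⨾ whileNonzero (monus e (reg x)) (p ⨾ setReg x (plus (reg x) (lit 1)))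

-- A round costs its body, one increment and one test; the leading 2 pays for the initialisation and
-- the final test.
forᵗ : ∀ (I : ℕ → State → Set) x e m {p T} → (∀ {j σ} → I j σ → ⟦ e ⟧ σ ≡ m) → (∀ {j} → Stable x (I j)) →
       (∀ (i : Fin m) → Triple (λ σ → I (toℕ i) σ × regs σ x ≡ toℕ i) p T (λ σ → I (suc (toℕ i)) σ × regs σ x ≡ toℕ i)) →
       Triple (I 0) (for x e p) (2 + m * (T + 2)) (I m)
forᵗ I x e m {p} {T} bound stable body σ inv =
  let t , τ , loop⇓ , t≤ , inv′ = loop m 0 refl _ (stable 0 σ inv , update-same (regs σ) x 0)
  in suc t , τ , (setReg ⨾ loop⇓) , s≤s t≤ , inv′
  where
  loop : ∀ r j → j + r ≡ m → Triple (λ σ → I j σ × regs σ x ≡ j)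
         (whileNonzero (monus e (reg x)) (p ⨾ setReg x (plus (reg x) (lit 1)))) (1 + r * (T + 2)) (I m)
  loop zero j j+0≡m σ (inv , at) =
    1 , σ , whileStop (trans (cong₂ _∸_ (bound inv) at) (trans (cong (m ∸_) j≡m) (ℕ.n∸n≡0 m))) , ℕ.≤-refl ,
    subst (λ j → I j σ) j≡m inv
    where j≡m = trans (sym (ℕ.+-identityʳ j)) j+0≡m
  loop (suc r) j j+r≡m σ (inv , at) =
    let s , τ , p⇓ , s≤T , inv′ , at′ = body i σ (subst (λ j → I j σ × regs σ x ≡ j) (sym i≡j) (inv , at))
        t , υ , loop⇓ , t≤ , done = loop r (suc j) (trans (sym (ℕ.+-suc j r)) j+r≡m) _
          (subst (λ j → I (suc j) (assign x (regs τ x + 1) τ)) i≡j (stable _ τ inv′) ,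
           trans (update-same (regs τ) x _) (trans (ℕ.+-comm _ 1) (cong suc (trans at′ i≡j))))
    in suc ((s + 1) + t) , υ , whileStep running (p⇓ ⨾ setReg) loop⇓ ,
       s≤s (begin
         (s + 1) + t                     ≤⟨ ℕ.+-mono-≤ (ℕ.+-monoˡ-≤ 1 s≤T) t≤ ⟩
         (T + 1) + (1 + r * (T + 2))     ≡⟨ rearrange T (r * (T + 2)) ⟩
         (T + 2) + r * (T + 2)           ∎) ,
       done
    where
    open ℕ.≤-Reasoning
    rearrange : ∀ a b → (a + 1) + (1 + b) ≡ (a + 2) + b
    rearrange = solve-∀
    j<m : j < m
    j<m = subst (j <_) j+r≡m (ℕ.m<m+n j z<s)
    i : Fin m
    i = fromℕ< j<m
    i≡j : toℕ i ≡ j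
    i≡j = 𝔽.toℕ-fromℕ< j<m
    running : ⟦ monus e (reg x) ⟧ σ ≢ 0
    running zero∸ = ℕ.<⇒≱ j<m (ℕ.m∸n≡0⇒m≤n (trans (sym (cong₂ _∸_ (bound inv) at)) zero∸))

counter : ℕ
counter = 9

mul : ℕ → Expr → Expr → Program
mul z e f = setReg z (lit 0) ⨾ for counter e (setReg z (plus (reg z) f))

-- `z` is a variable here, so comparisons with `counter` do not compute; one orientation serves
-- reading the counter after writing `z`, the other the reverse.
mulᵗ : ∀ {F : State → Set} z e f m v → (counter ≡ᵇ z) ≡ false → (z ≡ᵇ counter) ≡ false →
       Stable z F → Stable counter F → (∀ {σ} → F σ → ⟦ e ⟧ σ ≡ m) → (∀ {σ} → F σ → ⟦ f ⟧ σ ≡ v) →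
       Triple F (mul z e f) (1 + (2 + m * 3)) (λ σ → F σ × regs σ z ≡ m * v)
mulᵗ {F} z e f m v c≢z z≢c stable-z stable-c value-e value-f =
  set z (lit 0) 0 stable-z (λ _ → refl) ⨾ᵗ
  forᵗ (λ j σ → F σ × regs σ z ≡ j * v) counter e m (value-e ∘ proj₁)
    (λ u σ (fσ , eq) → stable-c u σ fσ , trans (cong (if_then u else regs σ z) z≢c) eq)
    (λ i σ ((fσ , eq) , at) → 1 , _ , setReg , ℕ.≤-refl ,
      (stable-z _ σ fσ , trans (update-same (regs σ) z _) (trans (cong₂ _+_ eq (value-f fσ)) (ℕ.+-comm (toℕ i * v) v))) ,
      trans (cong (if_then regs σ z + ⟦ f ⟧ σ else regs σ counter) c≢z) at)

-- Output

-- Register 0 is the write pointer throughout, so at the end it holds the output length as required.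
Out : List ℕ → State → Set
Out zs σ = regs σ 0 ≡ length zs × (∀ i → i < length zs → arrs σ 1 i ≡ nth zs i)

nth-++ˡ : ∀ xs ys {i} → i < length xs → nth (xs ++ ys) i ≡ nth xs i
nth-++ˡ (x ∷ xs) ys {zero}  _         = refl
nth-++ˡ (x ∷ xs) ys {suc i} (s≤s i<n) = nth-++ˡ xs ys i<n

nth-++ʳ : ∀ xs ys i → nth (xs ++ ys) (length xs + i) ≡ nth ys i
nth-++ʳ []       ys i = refl
nth-++ʳ (x ∷ xs) ys i = nth-++ʳ xs ys i

nth-lookup : ∀ xs (i : Fin (length xs)) → nth xs (toℕ i) ≡ List.lookup xs i
nth-lookup (x ∷ xs) zero    = refl
nth-lookup (x ∷ xs) (suc i) = nth-lookup xs i

Out⇒HasOutput : ∀ zs σ → Out zs σ → HasOutput σ zs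
Out⇒HasOutput zs σ (ptr , cells) = ptr , λ i → trans (cells (toℕ i) (𝔽.toℕ<n i)) (nth-lookup zs i)

Triple⇒HaltsWith : ∀ {A B p T xs ys} → Triple A p T B → A (input xs) → (∀ σ → B σ → Out ys σ) →
                   ∃[ t ] (HaltsWith p xs t ys × t ≤ T)
Triple⇒HaltsWith {ys = ys} f a B⇒Out = let t , τ , p⇓ , t≤T , b = f _ a in t , (τ , p⇓ , Out⇒HasOutput ys τ (B⇒Out τ b)) , t≤T

emit : Expr → Program
emit e = setArr 1 (reg 0) e ⨾ setReg 0 (plus (reg 0) (lit 1))

afterEmit : ℕ → State → State
afterEmit v σ = state (regs σ [ 0 ↦ regs σ 0 + 1 ]) (arrs σ [ 1 ↦ arrs σ 1 [ regs σ 0 ↦ v ] ])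

Emits : (State → Set) → Program → ℕ → List ℕ → Set
Emits F p T xs = ∀ zs → Triple (λ σ → F σ × Out zs σ) p T (λ σ → F σ × Out (zs ++ xs) σ)

emitᵗ : ∀ {F : State → Set} e v → (∀ {u σ} → F σ → F (afterEmit u σ)) → (∀ {σ} → F σ → ⟦ e ⟧ σ ≡ v) →
        Emits F (emit e) 2 (v ∷ [])
emitᵗ e v stable value zs σ (f , ptr , cells) = 2 , _ , (setArr ⨾ setReg) , ℕ.≤-refl , stable f ,
  trans (cong (_+ 1) ptr) (sym (𝕃.length-++ zs)) , cells′
  where
  cells′ : ∀ i → i < length (zs ++ v ∷ []) → (arrs σ 1 [ regs σ 0 ↦ ⟦ e ⟧ σ ]) i ≡ nth (zs ++ v ∷ []) i
  cells′ i i< with ℕ.m≤n⇒m<n∨m≡n (s≤s⁻¹ (subst (i <_) (trans (𝕃.length-++ zs) (ℕ.+-comm _ 1)) i<))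
  ... | inj₁ old  = trans (update-other (arrs σ 1) _ λ i≡ → ℕ.<⇒≢ old (trans i≡ ptr))
                          (trans (cells i old) (sym (nth-++ˡ zs _ old)))
  ... | inj₂ refl = trans (trans (cong (arrs σ 1 [ regs σ 0 ↦ ⟦ e ⟧ σ ]) (sym ptr)) (update-same (arrs σ 1) (regs σ 0) _))
    (trans (value f) (trans (sym (nth-++ʳ zs (v ∷ []) 0)) (cong (nth (zs ++ v ∷ [])) (ℕ.+-identityʳ _))))

-- After `j` rounds the first `j` blocks have been appended. The counter has the form `suc x`, so
-- assigning it visibly spares register 0, the write pointer.
for-emits : ∀ {F : State → Set} x e m {p T} (f : Fin m → List ℕ) →
            (∀ {σ} → F σ → ⟦ e ⟧ σ ≡ m) → Stable (suc x) F →
            (∀ i → Emits (λ σ → F σ × regs σ (suc x) ≡ toℕ i) p T (f i)) →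
            Emits F (for (suc x) e p) (2 + m * (T + 2)) (concat (tabulate f))
for-emits {F} x e m f bound stable body zs =
  strengthen (λ σ (fσ , out) → fσ , subst (λ ys → Out ys σ) (sym (𝕃.++-identityʳ zs)) out)
  (weaken (λ σ (fσ , out) → fσ , subst (λ ys → Out (zs ++ concat ys) σ) (take-all f) out)
  (forᵗ (λ j σ → F σ × Out (zs ++ concat (take j (tabulate f))) σ) (suc x) e m
    (bound ∘ proj₁)
    (λ v σ (fσ , out) → stable v σ fσ , out)
    (λ i → strengthen (λ σ ((fσ , out) , at) → (fσ , at) , out)
      (weaken (λ σ ((fσ , at) , out) → (fσ , subst (λ ys → Out ys σ) (step i) out) , at)
        (body i (zs ++ concat (take (toℕ i) (tabulate f))))))))
  where
  take-all : ∀ {m} {A : Set} (f : Fin m → A) → take m (tabulate f) ≡ tabulate f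
  take-all {m} f = 𝕃.take-all m (tabulate f) (ℕ.≤-reflexive (𝕃.length-tabulate f))
  step : ∀ i → (zs ++ concat (take (toℕ i) (tabulate f))) ++ f i ≡ zs ++ concat (take (suc (toℕ i)) (tabulate f))
  step i = begin
    (zs ++ concat (take (toℕ i) (tabulate f))) ++ f i              ≡⟨ 𝕃.++-assoc zs _ _ ⟩
    zs ++ (concat (take (toℕ i) (tabulate f)) ++ f i)              ≡⟨ cong (λ ys → zs ++ (concat (take (toℕ i) (tabulate f)) ++ ys)) (𝕃.++-identityʳ (f i)) ⟨
    zs ++ (concat (take (toℕ i) (tabulate f)) ++ concat (f i ∷ [])) ≡⟨ cong (zs ++_) (𝕃.concat-++ (take (toℕ i) (tabulate f)) (f i ∷ [])) ⟩
    zs ++ concat (take (toℕ i) (tabulate f) ++ f i ∷ [])           ≡⟨ cong (λ ys → zs ++ concat ys) (𝕃.take-suc-tabulate f i) ⟨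
    zs ++ concat (take (suc (toℕ i)) (tabulate f))                 ∎
    where open ≡-Reasoning

-- Boolean expressions

notᵉ : Expr → Expr
notᵉ e = monus (lit 1) e

andᵉ orᵉ eqᵉ ltᵉ : Expr → Expr → Expr
andᵉ e f = notᵉ (plus (notᵉ e) (notᵉ f))
orᵉ e f  = notᵉ (notᵉ (plus e f))
eqᵉ e f  = notᵉ (plus (monus e f) (monus f e))
ltᵉ e f  = notᵉ (notᵉ (monus f e))

record Value (σ : State) (e : Expr) (v : ℕ) : Set where
  constructor value
  field value-eq : ⟦ e ⟧ σ ≡ v

record Bit (σ : State) (e : Expr) (b : Bool) : Set where
  constructor bit
  field bit-eq : ⟦ e ⟧ σ ≡ 𝟙 b

open Value
open Bit

module _ {σ : State} where
  not-value : ∀ {e b} → Bit σ e b → Bit σ (notᵉ e) (not b)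
  not-value {b = true}  (bit eq) = bit (cong (1 ∸_) eq)
  not-value {b = false} (bit eq) = bit (cong (1 ∸_) eq)

  -- The second operand only matters if the first holds, so that array reads can
  -- be guarded by range checks.
  and-value : ∀ {e f b c} → Bit σ e b → (b ≡ true → Bit σ f c) → Bit σ (andᵉ e f) (b ∧ c)
  and-value {f = f} {b = false} (bit eq) _ = bit (trans (cong (λ x → 1 ∸ ((1 ∸ x) + (1 ∸ ⟦ f ⟧ σ))) eq) (ℕ.0∸n≡0 (1 ∸ ⟦ f ⟧ σ)))
  and-value {b = true} {true}  (bit eq) second = bit (cong₂ (λ x y → 1 ∸ ((1 ∸ x) + (1 ∸ y))) eq (bit-eq (second refl)))
  and-value {b = true} {false} (bit eq) second = bit (cong₂ (λ x y → 1 ∸ ((1 ∸ x) + (1 ∸ y))) eq (bit-eq (second refl)))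

  and-false : ∀ {e f} → Bit σ e false → Bit σ (andᵉ e f) false
  and-false e-false = and-value {c = false} e-false λ ()

  or-value : ∀ {e f b c} → Bit σ e b → Bit σ f c → Bit σ (orᵉ e f) (b ∨ c)
  or-value {b = true}  {true}  (bit eq) (bit eq′) = bit (cong₂ (λ x y → 1 ∸ (1 ∸ (x + y))) eq eq′)
  or-value {b = true}  {false} (bit eq) (bit eq′) = bit (cong₂ (λ x y → 1 ∸ (1 ∸ (x + y))) eq eq′)
  or-value {b = false} {true}  (bit eq) (bit eq′) = bit (cong₂ (λ x y → 1 ∸ (1 ∸ (x + y))) eq eq′)
  or-value {b = false} {false} (bit eq) (bit eq′) = bit (cong₂ (λ x y → 1 ∸ (1 ∸ (x + y))) eq eq′)

  lt-true : ∀ {e f x y} → Value σ e x → Value σ f y → x < y → Bit σ (ltᵉ e f) true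
  lt-true {x = x} {y} (value refl) (value refl) x<y with y ∸ x in eq
  ... | suc d = bit (trans (cong (λ d → 1 ∸ (1 ∸ d)) eq) (cong (1 ∸_) (ℕ.0∸n≡0 d)))
  ... | zero  = contradiction (ℕ.m∸n≡0⇒m≤n eq) (ℕ.<⇒≱ x<y)

  lt-false : ∀ {e f x y} → Value σ e x → Value σ f y → y ≤ x → Bit σ (ltᵉ e f) false
  lt-false (value refl) (value refl) y≤x = bit (cong (λ d → 1 ∸ (1 ∸ d)) (ℕ.m≤n⇒m∸n≡0 y≤x))

  eq-false : ∀ {e f x y} → Value σ e x → Value σ f y → x ≢ y → Bit σ (eqᵉ e f) false
  eq-false {x = x} {y} (value refl) (value refl) x≢y = bit (differ x y x≢y)
    where
    differ : ∀ x y → x ≢ y → 1 ∸ ((x ∸ y) + (y ∸ x)) ≡ 0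
    differ x y x≢y with x ∸ y in e₁ | y ∸ x in e₂
    ... | suc d | d′    = ℕ.0∸n≡0 (d + d′)
    ... | zero  | suc d = ℕ.0∸n≡0 d
    ... | zero  | zero  = contradiction (ℕ.≤-antisym (ℕ.m∸n≡0⇒m≤n e₁) (ℕ.m∸n≡0⇒m≤n e₂)) x≢y

  eq-value : ∀ {e f m} {x y : Fin m} → Value σ e (toℕ x) → Value σ f (toℕ y) → Bit σ (eqᵉ e f) (does (x 𝔽.≟ y))
  eq-value {x = x} {y} (value ex) (value fy) with x 𝔽.≟ y
  ... | yes refl = bit (cong₂ (λ u v → 1 ∸ (u + v))
                     (trans (cong₂ _∸_ ex fy) (ℕ.n∸n≡0 (toℕ x))) (trans (cong₂ _∸_ fy ex) (ℕ.n∸n≡0 (toℕ x))))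
  ... | no x≢y   = eq-false (value ex) (value fy) (x≢y ∘ 𝔽.toℕ-injective)

-- The adjacency matrix of the gadget graph as an expression

length-rows : ∀ {m n} (f : Fin m → List ℕ) → (∀ i → length (f i) ≡ n) → length (concat (tabulate f)) ≡ m * n
length-rows {zero}  f len = refl
length-rows {suc m} f len = trans (𝕃.length-++ (f zero)) (cong₂ _+_ (len zero) (length-rows (f ∘ suc) (len ∘ suc)))

nth-rows : ∀ {m n} (f : Fin m → List ℕ) → (∀ i → length (f i) ≡ n) → ∀ i {j} → j < n →
           nth (concat (tabulate f)) (toℕ i * n + j) ≡ nth (f i) j
nth-rows {n = n} f len zero    {j} j<n = nth-++ˡ (f zero) _ (subst (j <_) (sym (len zero)) j<n)
nth-rows {n = n} f len (suc i) {j} j<n = trans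
  (cong (nth (f zero ++ _)) (trans (ℕ.+-assoc n (toℕ i * n) j) (cong (_+ (toℕ i * n + j)) (sym (len zero)))))
  (trans (nth-++ʳ (f zero) _ (toℕ i * n + j)) (nth-rows (f ∘ suc) (len ∘ suc) i j<n))

nth-tabulate : ∀ {n} (f : Fin n → ℕ) i → nth (tabulate f) (toℕ i) ≡ f i
nth-tabulate f zero    = refl
nth-tabulate f (suc i) = nth-tabulate (f ∘ suc) i

length-encodeGraph : ∀ {n} (G : Graph n) → length (encodeGraph G) ≡ n * n
length-encodeGraph G = length-rows (λ u → tabulate λ v → 𝟙 (adj G u v)) λ u → 𝕃.length-tabulate (λ v → 𝟙 (adj G u v))

nth-encodeGraph : ∀ {n} (G : Graph n) u v → nth (encodeGraph G) (toℕ u * n + toℕ v) ≡ 𝟙 (adj G u v)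
nth-encodeGraph G u v = trans
  (nth-rows (λ u → tabulate λ v → 𝟙 (adj G u v)) (λ u → 𝕃.length-tabulate (λ v → 𝟙 (adj G u v))) u (𝔽.toℕ<n v))
  (nth-tabulate (λ v → 𝟙 (adj G u v)) v)

data SplitView {m n} : Fin (m + n) → Fin m ⊎ Fin n → Set where
  left  : ∀ {x} i → toℕ x ≡ toℕ i → SplitView x (inj₁ i)
  right : ∀ {x} j → toℕ x ≡ m + toℕ j → SplitView x (inj₂ j)

splitView : ∀ m {n} (x : Fin (m + n)) → SplitView x (splitAt m x)
splitView m {n} x with splitAt m x in eq
... | inj₁ i = left i (trans (cong toℕ (sym (𝔽.splitAt⁻¹-↑ˡ eq))) (𝔽.toℕ-↑ˡ i n))
... | inj₂ j = right j (trans (cong toℕ (sym (𝔽.splitAt⁻¹-↑ʳ eq))) (𝔽.toℕ-↑ʳ m j))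

rn rk rP rW rL rN rQ offset : ℕ
rn = 1
rk = 2
rP = 3
rW = 4
rL = 5
rN = 6
rQ = 7
offset = 8

-- Padding hubs fail the range checks. Array 2 holds the offset at which each row of `G` starts in
-- the input, since expressions cannot multiply.
goodᵉ : Expr → Expr → Expr
goodᵉ c d = andᵉ (ltᵉ c (reg rn)) (andᵉ (ltᵉ d (reg rn)) (orᵉ (eqᵉ c d) (arr 0 (plus (arr 2 c) d))))

-- Positions of the later layers are at least `P`, above every possible `a`, so comparing suffices.
isHubᵉ : Expr → Expr → Expr
isHubᵉ a b = eqᵉ a b

-- The position `d` encodes the layer: below `P` a hub or subdivider, from there to `P + P` a second
-- vertex whose other end is `d` minus `P`, beyond that a pendant.
attachedᵉ : Expr → Expr → Expr → Expr
attachedᵉ c d h =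
  orᵉ (eqᵉ h c) (orᵉ (andᵉ (ltᵉ d (reg rP)) (eqᵉ h d))
    (andᵉ (ltᵉ d (plus (reg rP) (reg rP))) (andᵉ (notᵉ (ltᵉ d (reg rP)))
      (orᵉ (eqᵉ h (monus d (reg rP))) (notᵉ (goodᵉ c (monus d (reg rP))))))))

fromHubᵉ : Expr → Expr → Expr → Expr → Expr
fromHubᵉ a b c d = andᵉ (isHubᵉ a b) (andᵉ (notᵉ (isHubᵉ c d)) (attachedᵉ c d a))

adjacentᵉ : Expr → Expr → Expr → Expr → Expr
adjacentᵉ a b c d = orᵉ (fromHubᵉ a b c d) (fromHubᵉ c d a b)

module Evaluation {n} (G : Graph n) (k : ℕ) where
  open Reduction G k
  open Gadget P W good

  source : List ℕ
  source = n ∷ k ∷ encodeGraph G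

  Input : State → Set
  Input σ = (∀ i → arrs σ 0 i ≡ nth source i) × regs σ rn ≡ n

  Offsets : State → Set
  Offsets σ = ∀ i → i < n → arrs σ 2 i ≡ 2 + i * n

  module _ {σ : State} (in-σ : Input σ) (offsets : Offsets σ) (P-σ : regs σ rP ≡ P) where
    n-value : Value σ (reg rn) n
    n-value = value (proj₂ in-σ)

    P-value : Value σ (reg rP) P
    P-value = value P-σ

    2P-value : Value σ (plus (reg rP) (reg rP)) (P + P)
    2P-value = value (cong₂ _+_ P-σ P-σ)

    cell : ∀ {e f x y} → Value σ e (toℕ x) → Value σ f (toℕ y) → Bit σ (arr 0 (plus (arr 2 e) f)) (adj G x y)
    cell {x = x} {y} (value ex) (value fy) = bit (trans
      (cong (arrs σ 0) (cong₂ _+_ (trans (cong (arrs σ 2) ex) (offsets (toℕ x) (𝔽.toℕ<n x))) fy))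
      (trans (proj₁ in-σ (2 + toℕ x * n + toℕ y)) (nth-encodeGraph G x y)))

    good-value : ∀ {e f} (a b : Fin P) → Value σ e (toℕ a) → Value σ f (toℕ b) → Bit σ (goodᵉ e f) (good a b)
    good-value a b ea fb with splitAt n a | splitView n a
    ... | inj₂ a′ | right _ a≡ = and-false (lt-false ea n-value (subst (n ≤_) (sym a≡) (ℕ.m≤m+n n _)))
    ... | inj₁ a′ | left _ a≡ with splitAt n b | splitView n b
    ...   | inj₂ b′ | right _ b≡ = and-value (lt-true ea n-value (subst (_< n) (sym a≡) (𝔽.toℕ<n a′)))
      λ _ → and-false (lt-false fb n-value (subst (n ≤_) (sym b≡) (ℕ.m≤m+n n _)))
    ...   | inj₁ b′ | left _ b≡ = and-value (lt-true ea n-value (subst (_< n) (sym a≡) (𝔽.toℕ<n a′)))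
      λ _ → and-value (lt-true fb n-value (subst (_< n) (sym b≡) (𝔽.toℕ<n b′)))
      λ _ → or-value (eq-value ea′ fb′) (cell ea′ fb′)
      where
      ea′ = subst (Value σ _) a≡ ea
      fb′ = subst (Value σ _) b≡ fb

    LayerValue : Layer → ℕ → Set
    LayerValue (inj₁ b)        y = y ≡ toℕ b
    LayerValue (inj₂ (inj₁ b)) y = y ≡ P + toℕ b
    LayerValue (inj₂ (inj₂ w)) y = y ≡ P + (P + toℕ w)

    layer-value : ∀ b → LayerValue (layer b) (toℕ b)
    layer-value b with splitAt P b | splitView P b
    ... | inj₁ _ | left _ eq = eq
    ... | inj₂ j | right _ eq with splitAt P j | splitView P j
    ...   | inj₁ _ | left _ eq′  = trans eq (cong (P +_) eq′)
    ...   | inj₂ _ | right _ eq′ = trans eq (cong (P +_) eq′)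

    isHub-value : ∀ {e f} a l y → LayerValue l y → Value σ e (toℕ a) → Value σ f y → Bit σ (isHubᵉ e f) (isHub (a , l))
    isHub-value a (inj₁ b) y refl ea fy = eq-value ea fy
    isHub-value a (inj₂ (inj₁ b)) y refl ea fy = eq-false ea fy
      λ a≡ → ℕ.m+n≮m P (toℕ b) (subst (_< P) a≡ (𝔽.toℕ<n a))
    isHub-value a (inj₂ (inj₂ w)) y refl ea fy = eq-false ea fy
      λ a≡ → ℕ.m+n≮m P (P + toℕ w) (subst (_< P) a≡ (𝔽.toℕ<n a))

    attached-value : ∀ {e f g} c l y h → LayerValue l y → Value σ e (toℕ c) → Value σ f y → Value σ g (toℕ h) →
                     Bit σ (attachedᵉ e f g) (attached (c , l) h)
    attached-value {f = f} c (inj₁ d) y h refl ec fy gh = subst (Bit σ _)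
      (cong (does (h 𝔽.≟ c) ∨_) (𝔹.∨-identityʳ _))
      (or-value (eq-value gh ec) (or-value
        (and-value below (λ _ → eq-value gh fy))
        (and-value (lt-true fy 2P-value (ℕ.<-≤-trans (𝔽.toℕ<n d) (ℕ.m≤m+n P P)))
          λ _ → and-false (not-value below))))
      where
      below : Bit σ (ltᵉ f (reg rP)) true
      below = lt-true fy P-value (𝔽.toℕ<n d)
    attached-value {f = f} c (inj₂ (inj₁ d)) y h refl ec fy gh = subst (Bit σ _)
      (sym (𝔹.∨-assoc (does (h 𝔽.≟ c)) (does (h 𝔽.≟ d)) (not (good c d))))
      (or-value (eq-value gh ec) (or-value
        (and-false above)
        (and-value (lt-true fy 2P-value (ℕ.+-monoʳ-< P (𝔽.toℕ<n d)))
          λ _ → and-value (not-value above)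
          λ _ → or-value (eq-value gh shifted) (not-value (good-value c d ec shifted)))))
      where
      above : Bit σ (ltᵉ f (reg rP)) false
      above = lt-false fy P-value (ℕ.m≤m+n P (toℕ d))
      shifted : Value σ (monus f (reg rP)) (toℕ d)
      shifted = value (trans (cong₂ _∸_ (value-eq fy) P-σ) (ℕ.m+n∸m≡n P (toℕ d)))
    attached-value c (inj₂ (inj₂ w)) y h refl ec fy gh = subst (Bit σ _)
      (𝔹.∨-identityʳ _)
      (or-value (eq-value gh ec) (or-value
        (and-false (lt-false fy P-value (ℕ.m≤m+n P _)))
        (and-false (lt-false fy 2P-value (ℕ.+-monoʳ-≤ P (ℕ.m≤m+n P (toℕ w)))))))

    fromHub-value : ∀ {e f e′ f′} a b c d → Value σ e (toℕ a) → Value σ f (toℕ b) → Value σ e′ (toℕ c) → Value σ f′ (toℕ d) →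
                    Bit σ (fromHubᵉ e f e′ f′) (fromHub (a , layer b) (c , layer d))
    fromHub-value a b c d ea fb ec fd =
      and-value (isHub-value a (layer b) (toℕ b) (layer-value b) ea fb) λ _ →
      and-value (not-value (isHub-value c (layer d) (toℕ d) (layer-value d) ec fd)) λ _ →
      attached-value c (layer d) (toℕ d) a (layer-value d) ec fd ea

    adjacent-value : ∀ {e f e′ f′} a b c d → Value σ e (toℕ a) → Value σ f (toℕ b) → Value σ e′ (toℕ c) → Value σ f′ (toℕ d) →
                     Bit σ (adjacentᵉ e f e′ f′) (adjV (a , layer b) (c , layer d))
    adjacent-value a b c d ea fb ec fd =
      or-value (fromHub-value a b c d ea fb ec fd) (fromHub-value c d a b ec fd ea fb)

-- The reduction as a program

tabulate-+ : ∀ {A : Set} m {n} (f : Fin (m + n) → A) → tabulate f ≡ tabulate (λ i → f (i ↑ˡ n)) ++ tabulate (λ j → f (m ↑ʳ j))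
tabulate-+ zero    f = refl
tabulate-+ (suc m) f = cong (f zero ∷_) (tabulate-+ m (f ∘ suc))

concat-tabulate-× : ∀ {A : Set} m {n} (f : Fin (m * n) → List A) →
                    concat (tabulate f) ≡ concat (tabulate λ (i : Fin m) → concat (tabulate λ (j : Fin n) → f (combine i j)))
concat-tabulate-× zero        f = refl
concat-tabulate-× (suc m) {n} f = begin
  concat (tabulate f)                                                                   ≡⟨ cong concat (tabulate-+ n f) ⟩
  concat (tabulate (λ j → f (j ↑ˡ (m * n))) ++ tabulate (λ x → f (n ↑ʳ x)))             ≡⟨ 𝕃.concat-++ (tabulate λ j → f (j ↑ˡ (m * n))) _ ⟨
  concat (tabulate λ j → f (j ↑ˡ (m * n))) ++ concat (tabulate λ x → f (n ↑ʳ x))        ≡⟨ cong (concat (tabulate λ j → f (j ↑ˡ (m * n))) ++_) (concat-tabulate-× m (λ x → f (n ↑ʳ x))) ⟩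
  concat (tabulate λ (i : Fin (suc m)) → concat (tabulate λ (j : Fin n) → f (combine i j)))  ∎
  where open ≡-Reasoning

concat-tabulate-singletons : ∀ {A : Set} {n} (f : Fin n → A) → concat (tabulate λ i → f i ∷ []) ≡ tabulate f
concat-tabulate-singletons {n = zero}  f = refl
concat-tabulate-singletons {n = suc n} f = cong (f zero ∷_) (concat-tabulate-singletons (f ∘ suc))

-- Four loops run through the coordinates of both vertices, which avoids decoding by division;
-- `concat-tabulate-×` matches their order with that of `encodeGraph`.
emitMatrix : Program
emitMatrix =
  for 10 (reg rP) (for 11 (reg rL) (for 12 (reg rP) (for 13 (reg rL)
    (emit (adjacentᵉ (reg 10) (reg 11) (reg 12) (reg 13))))))

computeOffsets : Program
computeOffsets = setReg offset (lit 2) ⨾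
  for counter (reg rn) (setArr 2 (reg counter) (reg offset) ⨾ setReg offset (plus (reg offset) (reg rn)))

reductionProgram : Program
reductionProgram =
  setReg rn (arr 0 (lit 0)) ⨾
  setReg rk (arr 0 (lit 1)) ⨾
  setReg rP (plus (reg rn) (plus (reg rk) (plus (plus (lit 1) (reg rk)) (plus (lit 1) (reg rk))))) ⨾
  mul rW (reg rP) (plus (reg rP) (reg rP)) ⨾
  setReg rL (plus (reg rP) (plus (reg rP) (reg rW))) ⨾
  mul rN (reg rP) (reg rL) ⨾
  mul rQ (reg rk) (plus (reg rk) (plus (reg rk) (reg rW))) ⨾
  computeOffsets ⨾
  -- Register 0 still holds the input length; from here on it is the write pointer.
  setReg 0 (lit 0) ⨾
  emit (reg rN) ⨾
  emit (reg rk) ⨾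
  emit (monus (reg rN) (reg rQ)) ⨾
  emitMatrix

matrixTime : ℕ → ℕ → ℕ
matrixTime P L = 2 + P * ((2 + L * ((2 + P * ((2 + L * (2 + 2)) + 2)) + 2)) + 2)

-- The nesting mirrors that of the program, so `programᵗ` has this bound by computation.
runningTime : ℕ → ℕ → ℕ → ℕ → ℕ
runningTime n k P L =
  1 + (1 + (1 + ((1 + (2 + P * 3)) + (1 + ((1 + (2 + P * 3)) + ((1 + (2 + k * 3)) +
  ((1 + (2 + n * 4)) + (1 + (2 + (2 + (2 + matrixTime P L)))))))))))

module Correctness {n} (G : Graph n) (k : ℕ) where
  open Reduction G k
  open Gadget P W good
  open Evaluation G k

  -- Nested to the left because every `set` and `mulᵗ` appends one equation.
  Sizes Setup : State → Set
  Sizes σ = ((((((Input σ × regs σ rk ≡ k) × regs σ rP ≡ P) × regs σ rW ≡ W) × regs σ rL ≡ L) × regs σ rN ≡ N) × regs σ rQ ≡ quota k)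
  Setup σ = Sizes σ × Offsets σ

  offsetsᵗ : Triple Sizes computeOffsets (1 + (2 + n * 4)) Setup
  offsetsᵗ = set offset (lit 2) 2 (λ v σ f → f) (λ _ → refl) ⨾ᵗ
    strengthen (λ σ (f , eq) → f , eq , λ i ())
    (weaken (λ σ (f , _ , cells) → f , cells)
    (forᵗ Progress counter (reg rn) n (λ ((((((((_ , eq) , _) , _) , _) , _) , _) , _) , _) → eq) (λ v σ f → f)
      λ i σ (inv , at) → 2 , _ , (setArr ⨾ setReg) , ℕ.≤-refl , step i σ inv at , at))
    where
    Progress : ℕ → State → Set
    Progress j σ = Sizes σ × (regs σ offset ≡ 2 + j * n × (∀ i → i < j → arrs σ 2 i ≡ 2 + i * n))
    step : ∀ i σ → Progress (toℕ i) σ → regs σ counter ≡ toℕ i →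
           Progress (suc (toℕ i)) (state (regs σ [ offset ↦ regs σ offset + regs σ rn ])
                                         (arrs σ [ 2 ↦ arrs σ 2 [ regs σ counter ↦ regs σ offset ] ]))
    step i σ (f@(((((((_ , n-σ) , _) , _) , _) , _) , _) , _) , next , cells) at =
      f , trans (cong₂ _+_ next n-σ) (rearrange (toℕ i * n) n) , cells′
      where
      rearrange : ∀ a b → (2 + a) + b ≡ 2 + (b + a)
      rearrange = solve-∀
      cells′ : ∀ j → j < suc (toℕ i) → (arrs σ 2 [ regs σ counter ↦ regs σ offset ]) j ≡ 2 + j * n
      cells′ j j≤i with ℕ.m≤n⇒m<n∨m≡n (s≤s⁻¹ j≤i)
      ... | inj₁ j<i  = trans (update-other (arrs σ 2) _ λ j≡ → ℕ.<⇒≢ j<i (trans j≡ at)) (cells j j<i)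
      ... | inj₂ refl = trans (cong (arrs σ 2 [ regs σ counter ↦ regs σ offset ]) (sym at))
                              (trans (update-same (arrs σ 2) (regs σ counter) (regs σ offset)) next)

  rows : List ℕ
  rows = concat (tabulate λ a → concat (tabulate λ b → concat (tabulate λ c → concat (tabulate λ d →
    𝟙 (adjV (a , layer b) (c , layer d)) ∷ []))))

  rows≡ : rows ≡ encodeGraph H
  rows≡ = sym (trans (concat-tabulate-× P row)
    (cong concat (𝕃.tabulate-cong λ a → cong concat (𝕃.tabulate-cong λ b →
      trans (sym (concat-tabulate-singletons (entry (combine a b))))
      (trans (concat-tabulate-× P (λ y → entry (combine a b) y ∷ []))
      (cong concat (𝕃.tabulate-cong λ c → cong concat (𝕃.tabulate-cong λ d →
        cong (λ e → 𝟙 e ∷ []) (cong₂ adjV (vertex-combine a b) (vertex-combine c d))))))))))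
    where
    entry : Fin N → Fin N → ℕ
    entry x y = 𝟙 (adj H x y)
    row : Fin N → List ℕ
    row x = tabulate (entry x)

  P-eq : ∀ σ → Setup σ → regs σ rP ≡ P
  P-eq σ ((((((_ , eq) , _) , _) , _) , _) , _) = eq

  L-eq : ∀ σ → Setup σ → regs σ rL ≡ L
  L-eq σ ((((_ , eq) , _) , _) , _) = eq

  matrixᵗ : Emits Setup emitMatrix (matrixTime P L) rows
  matrixᵗ =
    for-emits 9 (reg rP) P _ (λ {σ} → P-eq σ) (λ v σ f → f) λ a →
    for-emits 10 (reg rL) L _ (λ {σ} (f , _) → L-eq σ f) (λ v σ f → f) λ b →
    for-emits 11 (reg rP) P _ (λ {σ} ((f , _) , _) → P-eq σ f) (λ v σ f → f) λ c →
    for-emits 12 (reg rL) L _ (λ {σ} (((f , _) , _) , _) → L-eq σ f) (λ v σ f → f) λ d →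
    emitᵗ entryᵉ _ (λ f → f) λ {σ} ((((f , eq-a) , eq-b) , eq-c) , eq-d) → entry-value σ f eq-a eq-b eq-c eq-d
    where
    entryᵉ : Expr
    entryᵉ = adjacentᵉ (reg 10) (reg 11) (reg 12) (reg 13)
    entry-value : ∀ σ {a b c d} → Setup σ → regs σ 10 ≡ toℕ a → regs σ 11 ≡ toℕ b → regs σ 12 ≡ toℕ c → regs σ 13 ≡ toℕ d →
                  ⟦ entryᵉ ⟧ σ ≡ 𝟙 (adjV (a , layer b) (c , layer d))
    entry-value σ {a} {b} {c} {d} f@(((((((in-σ , _) , _) , _) , _) , _) , _) , offsets) eq-a eq-b eq-c eq-d =
      bit-eq {e = entryᵉ} (adjacent-value {σ} in-σ offsets (P-eq σ f) a b c d (value eq-a) (value eq-b) (value eq-c) (value eq-d))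

  headerᵗ : Triple (λ σ → Setup σ × Out [] σ)
    (emit (reg rN) ⨾ emit (reg rk) ⨾ emit (monus (reg rN) (reg rQ)) ⨾ emitMatrix)
    (2 + (2 + (2 + matrixTime P L)))
    (λ σ → Setup σ × Out (N ∷ k ∷ (N ∸ quota k) ∷ rows) σ)
  headerᵗ =
    emitᵗ (reg rN) N (λ f → f) (λ (((_ , eq) , _) , _) → eq) [] ⨾ᵗ
    emitᵗ (reg rk) k (λ f → f) (λ (((((((_ , eq) , _) , _) , _) , _) , _) , _) → eq) (N ∷ []) ⨾ᵗ
    emitᵗ (monus (reg rN) (reg rQ)) (N ∸ quota k) (λ f → f) (λ (((_ , eq) , eq′) , _) → cong₂ _∸_ eq eq′) (N ∷ k ∷ []) ⨾ᵗ
    matrixᵗ (N ∷ k ∷ (N ∸ quota k) ∷ [])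

  programᵗ : Triple (λ σ → ∀ i → arrs σ 0 i ≡ nth source i) reductionProgram (runningTime n k P L)
             (λ σ → Setup σ × Out (N ∷ k ∷ (N ∸ quota k) ∷ rows) σ)
  programᵗ =
    set rn (arr 0 (lit 0)) n (λ v σ f → f) (λ f → f 0) ⨾ᵗ
    set rk (arr 0 (lit 1)) k (λ v σ f → f) (λ (f , _) → f 1) ⨾ᵗ
    set rP _ P (λ v σ f → f) (λ ((_ , eq) , eq′) → cong₂ _+_ eq (cong (λ z → z + (suc z + suc z)) eq′)) ⨾ᵗ
    mulᵗ rW (reg rP) _ P (P + P) refl refl (λ v σ f → f) (λ v σ f → f) proj₂ (λ (_ , eq) → cong₂ _+_ eq eq) ⨾ᵗ
    set rL _ L (λ v σ f → f) (λ ((_ , eq) , eq′) → cong₂ (λ p w → p + (p + w)) eq eq′) ⨾ᵗ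
    mulᵗ rN (reg rP) (reg rL) P L refl refl (λ v σ f → f) (λ v σ f → f) (λ (((_ , eq) , _) , _) → eq) proj₂ ⨾ᵗ
    mulᵗ rQ (reg rk) _ k (k + (k + W)) refl refl (λ v σ f → f) (λ v σ f → f)
      (λ (((((_ , eq) , _) , _) , _) , _) → eq)
      (λ (((((_ , eq) , _) , eq′) , _) , _) → cong₂ (λ c w → c + (c + w)) eq eq′) ⨾ᵗ
    offsetsᵗ ⨾ᵗ
    weaken (λ σ (f , eq) → f , eq , λ i ()) (set 0 (lit 0) 0 (λ v σ f → f) λ _ → refl) ⨾ᵗ
    headerᵗ

  reduction-runs : ∃[ t ] (HaltsWith reductionProgram source t (N ∷ k ∷ (N ∸ quota k) ∷ encodeGraph H) × t ≤ runningTime n k P L)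
  reduction-runs = Triple⇒HaltsWith programᵗ (λ _ → refl)
    λ σ (_ , out) → subst (λ ys → Out (N ∷ k ∷ (N ∸ quota k) ∷ ys) σ) rows≡ out

-- Running time

-- The overhead of a loop is absorbed into the constant, so the bound stays a product and can be
-- nested.
loopTime : ∀ {m M T U} c → m ≤ M → T ≤ c * U → 1 ≤ M → 1 ≤ U → 2 + m * (T + 2) ≤ (4 + c) * (M * U)
loopTime {m} {M} {T} {U} c m≤M T≤cU 1≤M 1≤U = begin
  2 + m * (T + 2)                            ≤⟨ ℕ.+-mono-≤ (ℕ.*-monoʳ-≤ 2 (ℕ.*-mono-≤ 1≤M 1≤U))
                                                  (ℕ.*-mono-≤ m≤M (ℕ.+-mono-≤ T≤cU (ℕ.*-monoʳ-≤ 2 1≤U))) ⟩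
  2 * (M * U) + M * (c * U + 2 * U)          ≡⟨ collect M U c ⟩
  (4 + c) * (M * U)                          ∎
  where
  open ℕ.≤-Reasoning
  collect : ∀ M U c → 2 * (M * U) + M * (c * U + 2 * U) ≡ (4 + c) * (M * U)
  collect = solve-∀

matrixTime≤ : ∀ {P L X} → P ≤ X → L ≤ 2 * (X * X) → 1 ≤ X → matrixTime P L ≤ 72 * X ^ 6
matrixTime≤ {P} {L} {X} P≤X L≤ 1≤X = ℕ.≤-trans
  -- Each of the four loops adds 4 to the initial 2, giving 18; the two loops over `L` contribute a
  -- factor 2 each.
  (loopTime 14 P≤X (loopTime 10 L≤ (loopTime 6 P≤X (loopTime 2 L≤ ℕ.≤-refl 1≤Y ℕ.≤-refl) 1≤X 1≤U₁) 1≤Y 1≤U₂) 1≤X 1≤U₃)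
  (ℕ.≤-reflexive (collect X))
  where
  1≤Y : 1 ≤ 2 * (X * X)
  1≤Y = ℕ.*-mono-≤ {1} {2} (s≤s z≤n) (ℕ.*-mono-≤ 1≤X 1≤X)
  1≤U₁ : 1 ≤ 2 * (X * X) * 1
  1≤U₁ = ℕ.*-mono-≤ 1≤Y (ℕ.≤-refl {1})
  1≤U₂ : 1 ≤ X * (2 * (X * X) * 1)
  1≤U₂ = ℕ.*-mono-≤ 1≤X 1≤U₁
  1≤U₃ : 1 ≤ 2 * (X * X) * (X * (2 * (X * X) * 1))
  1≤U₃ = ℕ.*-mono-≤ 1≤Y 1≤U₂
  collect : ∀ X → 18 * (X * (2 * (X * X) * (X * (2 * (X * X) * 1)))) ≡ 72 * (X * (X * (X * (X * (X * (X * 1))))))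
  collect = solve-∀

runningTime≤ : ∀ {n k P L Y} → n ≤ Y → k ≤ Y → P ≤ Y → 1 ≤ Y → matrixTime P L ≤ 72 * Y → runningTime n k P L ≤ 108 * Y
runningTime≤ {n} {k} {P} {L} {Y} n≤Y k≤Y P≤Y 1≤Y main≤ = begin
  runningTime n k P L                                               ≡⟨ gather n k P (matrixTime P L) ⟩
  23 * 1 + (6 * P + (3 * k + (4 * n + matrixTime P L)))             ≤⟨ ℕ.+-mono-≤ (ℕ.*-monoʳ-≤ 23 1≤Y) (ℕ.+-mono-≤ (ℕ.*-monoʳ-≤ 6 P≤Y)
                                                                         (ℕ.+-mono-≤ (ℕ.*-monoʳ-≤ 3 k≤Y) (ℕ.+-mono-≤ (ℕ.*-monoʳ-≤ 4 n≤Y) main≤))) ⟩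
  23 * Y + (6 * Y + (3 * Y + (4 * Y + 72 * Y)))                     ≡⟨ total Y ⟩
  108 * Y                                                           ∎
  where
  open ℕ.≤-Reasoning
  gather : ∀ n k P M →
    1 + (1 + (1 + ((1 + (2 + P * 3)) + (1 + ((1 + (2 + P * 3)) + ((1 + (2 + k * 3)) +
    ((1 + (2 + n * 4)) + (1 + (2 + (2 + (2 + M)))))))))))
    ≡ 23 * 1 + (6 * P + (3 * k + (4 * n + M)))
  gather = solve-∀
  total : ∀ Y → 23 * Y + (6 * Y + (3 * Y + (4 * Y + 72 * Y))) ≡ 108 * Y
  total = solve-∀

length≤size : ∀ xs → length xs ≤ size xs
length≤size []       = z≤n
length≤size (x ∷ xs) = s≤s (ℕ.≤-trans (length≤size xs) (ℕ.m≤n+m (size xs) ⌊log₂ x ⌋))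

suc≤2^ : ∀ k → suc k ≤ 2 ^ k
suc≤2^ zero    = ℕ.≤-refl
suc≤2^ (suc k) = begin
  suc (suc k)            ≤⟨ s≤s (ℕ.m≤n+m (suc k) k) ⟩
  suc k + suc k          ≤⟨ ℕ.+-mono-≤ (suc≤2^ k) (suc≤2^ k) ⟩
  2 ^ k + 2 ^ k          ≡⟨ cong (2 ^ k +_) (ℕ.+-identityʳ (2 ^ k)) ⟨
  2 ^ suc k              ∎
  where open ℕ.≤-Reasoning

-- The sixth power of `4 * 2 ^ k` from `P<bound`, times the 108 of `runningTime≤`. Bounding `suc k`
-- by a power of two lets doubling compute the factor.
timeFactor : ℕ → ℕ
timeFactor k = 2 ^ (k * 6) * (108 * 4 ^ 6)

module TimeBound {n} (G : Graph n) (k : ℕ) where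
  open Reduction G k
  open Gadget P W good

  instanceSize : ℕ
  instanceSize = size (n ∷ k ∷ encodeGraph G)

  -- The number `n` alone has about log n digits, but each of the n² matrix entries contributes a
  -- digit.
  n<instanceSize : suc n ≤ instanceSize
  n<instanceSize = begin
    suc n                                  ≤⟨ s≤s (n≤1+n² n) ⟩
    2 + n * n                              ≡⟨ cong (2 +_) (length-encodeGraph G) ⟨
    length (n ∷ k ∷ encodeGraph G)         ≤⟨ length≤size (n ∷ k ∷ encodeGraph G) ⟩
    instanceSize                           ∎
    where
    open ℕ.≤-Reasoning
    n≤1+n² : ∀ n → n ≤ suc (n * n)
    n≤1+n² zero    = z≤n
    n≤1+n² (suc n) = ℕ.m≤n⇒m≤1+n (ℕ.m≤m*n (suc n) (suc n))

  P<bound : suc P ≤ 4 * (2 ^ k * instanceSize)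
  P<bound = begin
    suc P                                              ≤⟨ ℕ.m≤m+n (suc P) _ ⟩
    suc P + (k + (k + (k + 2))) * n                    ≡⟨ collect n k ⟩
    3 * (suc k * suc n)                                ≤⟨ ℕ.*-mono-≤ {3} {4} (ℕ.n≤1+n 3) (ℕ.*-mono-≤ (suc≤2^ k) n<instanceSize) ⟩
    4 * (2 ^ k * instanceSize)                         ∎
    where
    open ℕ.≤-Reasoning
    collect : ∀ n k → suc (n + (k + (suc k + suc k))) + (k + (k + (k + 2))) * n ≡ 3 * (suc k * suc n)
    collect = solve-∀

  L≤ : L ≤ 2 * (suc P * suc P)
  L≤ = ℕ.≤-trans (ℕ.m≤m+n L _) (ℕ.≤-reflexive (collect P))
    where
    collect : ∀ P → (P + (P + P * (P + P))) + (2 * P + 2) ≡ 2 * (suc P * suc P)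
    collect = solve-∀

  ^-distribʳ-* : ∀ a b m → (a * b) ^ m ≡ a ^ m * b ^ m
  ^-distribʳ-* a b zero    = refl
  ^-distribʳ-* a b (suc m) = trans (cong (a * b *_) (^-distribʳ-* a b m)) (interchange a b (a ^ m) (b ^ m))
    where
    interchange : ∀ a b c d → (a * b) * (c * d) ≡ (a * c) * (b * d)
    interchange = solve-∀

  power : ∀ a b y s → a * (b * (y * s)) ^ 6 ≡ (y ^ 6 * (a * b ^ 6)) * s ^ 6
  power a b y s = trans
    (cong (a *_) (trans (^-distribʳ-* b (y * s) 6) (cong (b ^ 6 *_) (^-distribʳ-* y s 6))))
    (regroup a (b ^ 6) (y ^ 6) (s ^ 6))
    where
    regroup : ∀ a b y s → a * (b * (y * s)) ≡ (y * (a * b)) * s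
    regroup = solve-∀

  runningTime-fpt : runningTime n k P L ≤ timeFactor k * instanceSize ^ 6
  runningTime-fpt = begin
    runningTime n k P L                                ≤⟨ runningTime≤ {n} {k} {P} {L} (≤X⁶ n≤X) (≤X⁶ k≤X) (≤X⁶ (ℕ.n≤1+n P)) (≤X⁶ 1≤X) (matrixTime≤ {P} {L} (ℕ.n≤1+n P) L≤ 1≤X) ⟩
    108 * suc P ^ 6                                    ≤⟨ ℕ.*-monoʳ-≤ 108 (ℕ.^-monoˡ-≤ 6 P<bound) ⟩
    108 * (4 * (2 ^ k * instanceSize)) ^ 6             ≡⟨ power 108 4 (2 ^ k) instanceSize ⟩
    ((2 ^ k) ^ 6 * (108 * 4 ^ 6)) * instanceSize ^ 6   ≡⟨ cong (λ z → (z * (108 * 4 ^ 6)) * instanceSize ^ 6) (ℕ.^-*-assoc 2 k 6) ⟩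
    timeFactor k * instanceSize ^ 6                    ∎
    where
    open ℕ.≤-Reasoning
    1≤X : 1 ≤ suc P
    1≤X = s≤s z≤n
    n≤X : n ≤ suc P
    n≤X = ℕ.≤-trans (ℕ.m≤m+n n padding) (ℕ.n≤1+n P)
    k≤X : k ≤ suc P
    k≤X = ℕ.≤-trans (ℕ.≤-trans (ℕ.m≤m+n k _) (ℕ.m≤n+m padding n)) (ℕ.n≤1+n P)
    ≤X⁶ : ∀ {m} → m ≤ suc P → m ≤ suc P ^ 6
    ≤X⁶ m≤X = ℕ.≤-trans m≤X (ℕ.≤-trans (ℕ.≤-reflexive (sym (ℕ.^-identityʳ (suc P)))) (ℕ.^-monoʳ-≤ (suc P) {1} {6} (s≤s z≤n)))

-- Computability of the parameter bound and of the time factor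

identity-computable : Computable id
identity-computable = setReg 0 (lit 0) ⨾ emit (arr 0 (lit 0)) , λ m →
  let t , halts , _ = Triple⇒HaltsWith (programᵗ m) (λ _ → refl) (λ σ → proj₂) in t , halts
  where
  programᵗ : ∀ m → Triple (λ σ → ∀ i → arrs σ 0 i ≡ nth (m ∷ []) i) (setReg 0 (lit 0) ⨾ emit (arr 0 (lit 0))) (1 + 2)
             (λ σ → (∀ i → arrs σ 0 i ≡ nth (m ∷ []) i) × Out (m ∷ []) σ)
  programᵗ m = weaken (λ σ (f , eq) → f , eq , λ i ()) (set 0 (lit 0) 0 (λ v σ f → f) λ _ → refl) ⨾ᵗ
               emitᵗ (arr 0 (lit 0)) m (λ f → f) (λ f → f 0) []

timeFactor-computable : Computable timeFactor
timeFactor-computable = program , λ k →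
  let t , halts , _ = Triple⇒HaltsWith (programᵗ (108 * 4 ^ 6) k) (λ _ → refl) (λ σ → proj₂) in t , halts
  where
  sixfold : Expr
  sixfold = plus (reg rn) (plus (reg rn) (plus (reg rn) (plus (reg rn) (plus (reg rn) (reg rn)))))
  -- Abstracting `c` keeps the large constant opaque during verification.
  programFrom : ℕ → Program
  programFrom c = setReg rn (arr 0 (lit 0)) ⨾ setReg rk (lit c) ⨾ for counter sixfold (setReg rk (plus (reg rk) (reg rk))) ⨾
                  setReg 0 (lit 0) ⨾ emit (reg rk)
  program : Program
  program = programFrom (108 * 4 ^ 6)
  programᵗ : ∀ c k → Triple (λ σ → ∀ i → arrs σ 0 i ≡ nth (k ∷ []) i) (programFrom c) (1 + (1 + ((2 + (k * 6) * 3) + (1 + 2))))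
             (λ σ → regs σ rk ≡ 2 ^ (k * 6) * c × Out (2 ^ (k * 6) * c ∷ []) σ)
  programᵗ c k =
    set rn (arr 0 (lit 0)) k (λ v σ f → f) (λ f → f 0) ⨾ᵗ
    strengthen (λ σ → proj₂) (set rk (lit c) c (λ v σ f → f) λ _ → refl) ⨾ᵗ
    strengthen (λ σ (eq , eq′) → eq , trans eq′ (sym (ℕ.+-identityʳ c)))
      (forᵗ (λ j σ → regs σ rn ≡ k × regs σ rk ≡ 2 ^ j * c) counter sixfold (k * 6)
        (λ (eq , _) → trans (cong (λ x → x + (x + (x + (x + (x + x))))) eq) (six k))
        (λ v σ f → f)
        λ i σ ((eq , eq′) , at) → 1 , _ , setReg , ℕ.≤-refl ,
          (eq , trans (cong₂ _+_ eq′ eq′) (double (2 ^ toℕ i) c)) , at) ⨾ᵗ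
    weaken (λ σ (eq , eq′) → eq , eq′ , λ i ()) (strengthen (λ σ → proj₂) (set 0 (lit 0) 0 (λ v σ f → f) λ _ → refl)) ⨾ᵗ
    emitᵗ (reg rk) (2 ^ (k * 6) * c) (λ f → f) (λ f → f) []
    where
    six : ∀ k → k + (k + (k + (k + (k + k)))) ≡ k * 6
    six = solve-∀
    double : ∀ x c → x * c + x * c ≡ (2 * x) * c
    double = solve-∀

theorem1p4 : W[1]-Hard RANK-INTEGRITY
theorem1p4 = record
  { reduce                    = λ (n , G , k) → Reduction.target G k
  ; correct                   = λ (n , G , k) → Reduction.reduction-correct G k
  ; parameterBound            = id
  ; parameterBound-computable = identity-computable
  ; parameter-bounded         = λ _ → ℕ.≤-refl
  ; program                   = reductionProgram
  ; factor                    = timeFactor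
  ; factor-computable         = timeFactor-computable
  ; exponent                  = 6
  ; runs                      = λ (n , G , k) →
      let t , halts , t≤ = Correctness.reduction-runs G k in t , halts , ℕ.≤-trans t≤ (TimeBound.runningTime-fpt G k)
  }
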